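{- Let $l\ge 2$ and let $L_{rel}$, $\mathbf{C}_n$, $\mathbf{S}_n$ and the probability measures $\delta_n^{\mathbf{C}}$ on $\mathbf{C}_n$ and $\delta_n^{\mathbf{S}}$ on $\mathbf{S}_n$ be as in the context. For every sentence $\varphi\in L_{rel}$: (i) $\lim_{n\to\infty}\delta_n^{\mathbf{C}}(\varphi)=0$ or $\lim_{n\to\infty}\delta_n^{\mathbf{C}}(\varphi)=1$, and (ii) (if, in addition, every relation symbol of $L_{rel}$ has arity at most $l$) $\lim_{n\to\infty}\delta_n^{\mathbf{S}}(\varphi)=0$ or $\lim_{n\to\infty}\delta_n^{\mathbf{S}}(\varphi)=1$. Here $\delta_n^{\mathbf{C}}(\varphi)=\delta_n^{\mathbf{C}}(\{\mathcal{M}\in\mathbf{C}_n:\mathcal{M}\models\varphi\})$ and similarly for $\mathbf{S}$.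
   Context: $l\ge2$ is a fixed integer. $L_{rel}$ is a first-order language with finite nonempty relational vocabulary, all of whose symbols have arity at least $2$. $L$ is the language whose vocabulary consists of that of $L_{rel}$ together with $l$ new unary relation symbols $P_1,\ldots,P_l$ ("colours"). An element $a$ of an $L$-structure has colour $i$ if it satisfies $P_i$. For $n\ge1$, $\mathbf{K}_n$ is the set of all $L$-structures $\mathcal{M}$ with universe $\{1,\ldots,n\}$ such that every element has exactly one colour and whenever $R$ is a relation symbol of $L_{rel}$ and $\mathcal{M}\models R(a_1,\ldots,a_m)$, at least two of $a_1,\ldots,a_m$ have different colours. $\mathbf{SK}_n$ is defined in the same way except that the last requirement is replaced by: whenever $\mathcal{M}\models R(a_1,\ldots,a_m)$, $a_i$ and $a_j$ have different colours for all $i\ne j$. $\mathbf{C}_n=\{\mathcal{M}\upharpoonright L_{rel}:\mathcal{M}\in\mathbf{K}_n\}$ and $\mathbf{S}_n=\{\mathcal{M}\upharpoonright L_{rel}:\mathcal{M}\in\mathbf{SK}_n\}$ (reducts). Dimension conditional measure (trivial pregeometry) on $\mathbf{X}_n$, for $\mathbf{X}_n=\mathbf{K}_n$ or $\mathbf{SK}_n$: for $\mathcal{M}\in\mathbf{X}_n$ and $d\in\mathbb{N}$, $\mathcal{M}\upharpoonright d$ is the $L$-structure with the same universe in which, for each relation symbol $R$ of $L$, $\bar a\in R^{\mathcal{M}\upharpoonright d}$ iff $\bar a\in R^{\mathcal{M}}$ and at most $d$ distinct elements occur in $\bar a$. $\mathbf{X}_n\upharpoonright d=\{\mathcal{M}\upharpoonright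 d:\mathcal{M}\in\mathbf{X}_n\}$. $\mathbb{P}_{n,0}$ is the uniform probability measure on $\mathbf{X}_n\upharpoonright0$ and, for $\mathcal{B}\in\mathbf{X}_n\upharpoonright(r+1)$, $\mathbb{P}_{n,r+1}(\mathcal{B})=\mathbb{P}_{n,r}(\mathcal{B}\upharpoonright r)\big/\big|\{\mathcal{B}'\in\mathbf{X}_n\upharpoonright(r+1):\mathcal{B}'\upharpoonright r=\mathcal{B}\upharpoonright r\}\big|$. With $\rho$ the largest arity of a relation symbol of $L$, the dimension conditional measure on $\mathbf{X}_n=\mathbf{X}_n\upharpoonright\rho$ is $\mathbb{P}_{n,\rho}$; it is denoted $\delta_n^{\mathbf{K}}$ for $\mathbf{K}_n$ and $\delta_n^{\mathbf{SK}}$ for $\mathbf{SK}_n$. For $\mathbf{Y}\subseteq\mathbf{C}_n$, $\delta_n^{\mathbf{C}}(\mathbf{Y})=\delta_n^{\mathbf{K}}(\{\mathcal{M}\in\mathbf{K}_n:\mathcal{M}\upharpoonright L_{rel}\in\mathbf{Y}\})$; for $\mathbf{Y}\subseteq\mathbf{S}_n$, $\delta_n^{\mathbf{S}}(\mathbf{Y})=\delta_n^{\mathbf{SK}}(\{\mathcal{M}\in\mathbf{SK}_n:\mathcal{M}\upharpoonright L_{rel}\in\mathbf{Y}\})$. -}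

module Defs where

open import Data.Bool using (Bool; true; false; T; _∧_)
import Data.Bool.Properties as Bool
open import Data.Fin using (Fin; zero; suc)
import Data.Fin.Properties as Fin
open import Data.Integer using (+_)
open import Data.List using
  (List; []; _∷_; _++_; map; filter; foldr; length; replicate; deduplicate; cartesianProductWith)
open import Data.List.Extrema.Nat using (max)
import Data.List.Membership.DecPropositional as DecMembership
open import Data.List.Membership.Propositional using (_∈_)
open import Data.List.Membership.Propositional.Properties using (∈-++⁺ˡ; ∈-++⁺ʳ)
open import Data.List.Relation.Unary.All as All using (All; []; _∷_)
open import Data.List.Relation.Unary.All.Properties using (++⁻ʳ)
open import Data.List.Relation.Unary.Any using (here; there)
open import Data.Nat using (ℕ; zero; suc; _≤ᵇ_; _≥_)
open import Data.Product using (∃; ∃₂; _×_; _,_; uncurry)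
open import Data.Rational using (ℚ; 0ℚ; _/_; _+_; _*_; _-_; _<_; ∣_∣)
open import Data.Sum using (_⊎_)
open import Data.Vec as Vec using (Vec; []; _∷_; lookup; toList)
import Data.Vec.Properties as Vec
open import Level using (0ℓ)
open import Relation.Binary using (DecidableEquality)
open import Relation.Binary.PropositionalEquality using (_≡_; _≢_; refl; cong₂)
open import Relation.Nullary using (¬_; Dec; yes; no)
open import Relation.Nullary.Decidable using (map′; T?; ¬?; _×-dec_; _⊎-dec_; _→-dec_)
open import Relation.Unary using (Pred; Decidable)

private variable
  A       : Set
  k l m n : ℕ

-- A finite relational vocabulary is the list of arities of its symbols;
-- a symbol of arity m is a position R : m ∈ τ.
Vocabulary : Set
Vocabulary = List ℕ

private variable
  σ τ : Vocabulary

-- An m-ary relation on Fin n, tabulated as an m-dimensional array, so that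
-- extensionally equal relations are propositionally equal.
Rel : ℕ → ℕ → Set
Rel n zero    = Bool
Rel n (suc m) = Vec (Rel n m) n

_at_ : Rel n m → Vec (Fin n) m → Bool
r at []       = r
r at (a ∷ as) = lookup r a at as

tabulate : (Vec (Fin n) m → Bool) → Rel n m
tabulate {m = zero}  f = f []
tabulate {m = suc m} f = Vec.tabulate λ a → tabulate λ as → f (a ∷ as)

-- The universe {1,…,n} is rendered as Fin n.
Structure : Vocabulary → ℕ → Set
Structure τ n = All (Rel n) τ

Holds : Structure τ n → m ∈ τ → Vec (Fin n) m → Set
Holds M R as = T (All.lookup M R at as)

_≟ᴿ_ : DecidableEquality (Rel n m)
_≟ᴿ_ {m = zero}  = Bool._≟_
_≟ᴿ_ {m = suc m} = Vec.≡-dec _≟ᴿ_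

_≟ˢ_ : DecidableEquality (Structure τ n)
[]      ≟ˢ []      = yes refl
(r ∷ M) ≟ˢ (s ∷ N) =
  map′ (uncurry (cong₂ _∷_)) (λ { refl → refl , refl }) (r ≟ᴿ s ×-dec M ≟ˢ N)

-- Each of the following three lists enumerates a finite type without repetition
-- (the first one provided xs does so for A).
vectors : List A → ∀ n → List (Vec A n)
vectors xs zero    = [] ∷ []
vectors xs (suc n) = cartesianProductWith _∷_ xs (vectors xs n)

relations : ∀ n m → List (Rel n m)
relations n zero    = true ∷ false ∷ []
relations n (suc m) = vectors (relations n m) n

structures : ∀ τ n → List (Structure τ n)
structures []      n = [] ∷ []
structures (m ∷ τ) n = cartesianProductWith _∷_ (relations n m) (structures τ n)

∀-vec? : {P : Pred (Vec (Fin n) m) 0ℓ} → Decidable P → Dec (∀ as → P as)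
∀-vec? {m = zero}  P? = map′ (λ { p [] → p }) (λ p → p []) (P? [])
∀-vec? {m = suc m} P? =
  map′ (λ { p (a ∷ as) → p a as }) (λ p a as → p (a ∷ as))
       (Fin.all? λ a → ∀-vec? λ as → P? (a ∷ as))

∀-symbol? : {P : ∀ {m} → m ∈ τ → Set} → (∀ {m} (R : m ∈ τ) → Dec (P R)) →
            Dec (∀ {m} (R : m ∈ τ) → P R)
∀-symbol? {τ = []}    P? = yes λ ()
∀-symbol? {τ = _ ∷ τ} {P} P? =
  map′ to (λ p → p (here refl) , λ {m} R → p (there R))
       (P? (here refl) ×-dec ∀-symbol? λ R → P? (there R))
  where
  to : P (here refl) × (∀ {m} (R : m ∈ τ) → P (there R)) → ∀ {m} (R : m ∈ _ ∷ τ) → P R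
  to (p , q) (here refl) = p
  to (p , q) (there R)   = q R

-- First-order formulas with equality and free variables among k de Bruijn indices.
infix  7 _≐_
infixr 6 _∧′_
infixr 5 _∨′_
infixr 4 _⇒′_

data Formula (τ : Vocabulary) (k : ℕ) : Set where
  _≐_            : Fin k → Fin k → Formula τ k
  rel            : m ∈ τ → Vec (Fin k) m → Formula τ k
  ¬′_            : Formula τ k → Formula τ k
  _∧′_ _∨′_ _⇒′_ : Formula τ k → Formula τ k → Formula τ k
  ∀′_ ∃′_        : Formula τ (suc k) → Formula τ k

Sentence : Vocabulary → Set
Sentence τ = Formula τ 0

_⊨_[_] : Structure τ n → Formula τ k → Vec (Fin n) k → Set
M ⊨ x ≐ y    [ v ] = lookup v x ≡ lookup v y
M ⊨ rel R xs [ v ] = Holds M R (Vec.map (lookup v) xs)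
M ⊨ ¬′ φ     [ v ] = ¬ (M ⊨ φ [ v ])
M ⊨ φ ∧′ ψ   [ v ] = M ⊨ φ [ v ] × M ⊨ ψ [ v ]
M ⊨ φ ∨′ ψ   [ v ] = M ⊨ φ [ v ] ⊎ M ⊨ ψ [ v ]
M ⊨ φ ⇒′ ψ   [ v ] = M ⊨ φ [ v ] → M ⊨ ψ [ v ]
M ⊨ ∀′ φ     [ v ] = ∀ a → M ⊨ φ [ a ∷ v ]
M ⊨ ∃′ φ     [ v ] = ∃ λ a → M ⊨ φ [ a ∷ v ]

_⊨_[_]? : (M : Structure τ n) (φ : Formula τ k) (v : Vec (Fin n) k) → Dec (M ⊨ φ [ v ])
M ⊨ x ≐ y    [ v ]? = lookup v x Fin.≟ lookup v y
M ⊨ rel R xs [ v ]? = T? _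
M ⊨ ¬′ φ     [ v ]? = ¬? (M ⊨ φ [ v ]?)
M ⊨ φ ∧′ ψ   [ v ]? = M ⊨ φ [ v ]? ×-dec M ⊨ ψ [ v ]?
M ⊨ φ ∨′ ψ   [ v ]? = M ⊨ φ [ v ]? ⊎-dec M ⊨ ψ [ v ]?
M ⊨ φ ⇒′ ψ   [ v ]? = M ⊨ φ [ v ]? →-dec M ⊨ ψ [ v ]?
M ⊨ ∀′ φ     [ v ]? = Fin.all? λ a → M ⊨ φ [ a ∷ v ]?
M ⊨ ∃′ φ     [ v ]? = Fin.any? λ a → M ⊨ φ [ a ∷ v ]?

_⊨?_ : (M : Structure τ n) (φ : Sentence τ) → Dec (M ⊨ φ [ [] ])
M ⊨? φ = M ⊨ φ [ [] ]?

Coloured : ℕ → Vocabulary → Vocabulary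
Coloured l σ = replicate l 1 ++ σ

colourSymbol : Fin l → 1 ∈ Coloured l σ
colourSymbol i = ∈-++⁺ˡ (position i)
  where
  position : Fin k → 1 ∈ replicate k 1
  position zero    = here refl
  position (suc i) = there (position i)

relSymbol : ∀ l → m ∈ σ → m ∈ Coloured l σ
relSymbol l = ∈-++⁺ʳ (replicate l 1)

reduct : ∀ l → Structure (Coloured l σ) n → Structure σ n
reduct l = ++⁻ʳ (replicate l 1)

module _ (l : ℕ) (σ : Vocabulary) {n : ℕ} (M : Structure (Coloured l σ) n) where

  HasColour : Fin n → Fin l → Set
  HasColour a i = Holds M (colourSymbol {σ = σ} i) (a ∷ [])

  OneColour : Set
  OneColour = ∀ a → ∃ λ i → HasColour a i × (∀ j → HasColour a j → j ≡ i)

  DifferentColours : Fin n → Fin n → Set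
  DifferentColours a b = ∃₂ λ i j → HasColour a i × HasColour b j × i ≢ j

  SomeDifferent : Vec (Fin n) m → Set
  SomeDifferent as = ∃₂ λ i j → DifferentColours (lookup as i) (lookup as j)

  AllDifferent : Vec (Fin n) m → Set
  AllDifferent as = ∀ i j → i ≢ j → DifferentColours (lookup as i) (lookup as j)

  IsK : Set
  IsK = OneColour ×
    (∀ {m} (R : m ∈ σ) (as : Vec (Fin n) m) → Holds M (relSymbol l R) as → SomeDifferent as)

  IsSK : Set
  IsSK = OneColour ×
    (∀ {m} (R : m ∈ σ) (as : Vec (Fin n) m) → Holds M (relSymbol l R) as → AllDifferent as)

  hasColour? : ∀ a i → Dec (HasColour a i)
  hasColour? a i = T? _

  oneColour? : Dec OneColour
  oneColour? = Fin.all? λ a → Fin.any? λ i →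
    hasColour? a i ×-dec Fin.all? λ j → hasColour? a j →-dec j Fin.≟ i

  differentColours? : ∀ a b → Dec (DifferentColours a b)
  differentColours? a b = Fin.any? λ i → Fin.any? λ j →
    hasColour? a i ×-dec hasColour? b j ×-dec ¬? (i Fin.≟ j)

  isK? : Dec IsK
  isK? = oneColour? ×-dec ∀-symbol? λ R → ∀-vec? λ as → T? _ →-dec
    (Fin.any? λ i → Fin.any? λ j → differentColours? (lookup as i) (lookup as j))

  isSK? : Dec IsSK
  isSK? = oneColour? ×-dec ∀-symbol? λ R → ∀-vec? λ as → T? _ →-dec
    (Fin.all? λ i → Fin.all? λ j →
      ¬? (i Fin.≟ j) →-dec differentColours? (lookup as i) (lookup as j))

-- Finite sets of structures are given as lists without repetition.
𝐊 𝐒𝐊 : ∀ l σ n → List (Structure (Coloured l σ) n)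
𝐊  l σ n = filter (isK?  l σ) (structures (Coloured l σ) n)
𝐒𝐊 l σ n = filter (isSK? l σ) (structures (Coloured l σ) n)

𝐂 𝐒 : ∀ l σ n → List (Structure σ n)
𝐂 l σ n = deduplicate _≟ˢ_ (map (reduct l) (𝐊  l σ n))
𝐒 l σ n = deduplicate _≟ˢ_ (map (reduct l) (𝐒𝐊 l σ n))

distinct : Vec (Fin n) m → ℕ
distinct as = length (deduplicate Fin._≟_ (toList as))

_↾_ : Structure τ n → ℕ → Structure τ n
M ↾ d = All.map (λ r → tabulate λ as → r at as ∧ (distinct as ≤ᵇ d)) M

_↾ᴸ_ : List (Structure τ n) → ℕ → List (Structure τ n)
X ↾ᴸ d = deduplicate _≟ˢ_ (map (_↾ d) X)

-- The value at zero is never used: only nonempty sets are counted below.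
1/_ : ℕ → ℚ
1/ zero    = 0ℚ
1/ (suc c) = + 1 / suc c

-- ℙ X r B is ℙ_{n,r}(B), meaningful for B in X ↾ᴸ r.
ℙ : List (Structure τ n) → ℕ → Structure τ n → ℚ
ℙ X zero    B = 1/ length (X ↾ᴸ 0)
ℙ X (suc r) B =
  ℙ X r (B ↾ r) * 1/ length (filter (λ B′ → (B′ ↾ r) ≟ˢ (B ↾ r)) (X ↾ᴸ suc r))

ρ : Vocabulary → ℕ
ρ τ = max 0 τ

-- δ X Y? is the dimension conditional measure on X of {M ∈ X : Y M}.
δ : (X : List (Structure τ n)) {Y : Pred (Structure τ n) 0ℓ} → Decidable Y → ℚ
δ {τ = τ} X Y? = foldr _+_ 0ℚ (map (ℙ X (ρ τ)) (filter Y? X))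

_∈ˢ?_ : (N : Structure σ n) (Y : List (Structure σ n)) → Dec (N ∈ Y)
_∈ˢ?_ = DecMembership._∈?_ _≟ˢ_

δᶜ δˢ : ∀ l σ n → List (Structure σ n) → ℚ
δᶜ l σ n Y = δ (𝐊  l σ n) (λ M → reduct l M ∈ˢ? Y)
δˢ l σ n Y = δ (𝐒𝐊 l σ n) (λ M → reduct l M ∈ˢ? Y)

δᶜ⟨_⟩ δˢ⟨_⟩ : Sentence σ → ℕ → ℕ → ℚ
δᶜ⟨_⟩ {σ} φ l n = δᶜ l σ n (filter (_⊨? φ) (𝐂 l σ n))
δˢ⟨_⟩ {σ} φ l n = δˢ l σ n (filter (_⊨? φ) (𝐒 l σ n))

_⟶_ : (ℕ → ℚ) → ℚ → Set
u ⟶ L = ∀ ε → 0ℚ < ε → ∃ λ N → ∀ n → n ≥ N → ∣ u n - L ∣ < ε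

{-# OPTIONS --safe #-}

-- Given the colouring, the dimension conditional measure makes every admissible tuple hold
-- independently with probability 1/2, and the colouring itself is uniform.  So it is the image of
-- the uniform measure on samples, i.e. pairs of an arbitrary colouring and arbitrary relations,
-- under deletion of the inadmissible tuples.  A uniform sample almost surely has every one-point
-- extension property: a failure at given parameters has probability at most (1 - 1/C)^(n - j) for
-- a constant C, and there are only polynomially many parameters.  In a sample with these
-- properties the truth of a sentence is found by letting quantifiers range over abstract one-point
-- extensions of the empty sample, a computation that does not depend on n.  The colours need not be
-- recovered from the reduct, since a sentence of the relational language has the same value in both.

module Submission where

open import Defs
open import Data.Bool using (Bool; true; false; T; _∧_; _xor_)
open import Data.Bool.Properties using (T-∧; ∧-assoc; ∧-zeroʳ; ∧-identityʳ)
open import Data.Empty using (⊥-elim)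
open import Data.Fin as Fin using (Fin; zero; suc)
import Data.Fin.Properties as Fin
open import Data.Integer as ℤ using (+[1+_])
import Data.Integer.Properties as ℤ
open import Data.List as List using
  (List; []; _∷_; _++_; map; filter; foldr; length; replicate; deduplicate; concatMap; allFin;
   cartesianProduct; cartesianProductWith)
open import Data.List.Extrema.Nat using (xs≤max)
import Data.List.Membership.DecPropositional as DecMembership
open import Data.List.Membership.Propositional using (_∈_; _∉_; lose)
open import Data.List.Membership.Propositional.Properties hiding (∈-lookup)
open import Data.List.Properties using
  (length-++; length-++-sucʳ; length-map; length-filter; length-tabulate; length-deduplicate;
   filter-≐; filter-none; filter-all)
open import Data.List.Relation.Unary.All as All using (All; []; _∷_)
open import Data.List.Relation.Unary.All.Properties using (++⁺; lookup-map)
open import Data.List.Relation.Unary.AllPairs using ([]; _∷_)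
open import Data.List.Relation.Unary.Any as Any using (here; there)
open import Data.List.Relation.Unary.Any.Properties using (¬Any[])
open import Data.List.Relation.Unary.Unique.DecPropositional.Properties using (deduplicate-!)
open import Data.List.Relation.Unary.Unique.Propositional using (Unique)
open import Data.List.Relation.Unary.Unique.Propositional.Properties using
  (allFin⁺; cartesianProduct⁺; cartesianProductWith⁺; filter⁺)
open import Data.Nat using
  (ℕ; zero; suc; _≤_; _<_; _≥_; _≤ᵇ_; z≤n; s≤s; _+_; _*_; _^_; _⊔_)
open import Data.Nat.DivMod using (_/_; _%_; m≡m%n+[m/n]*n; m%n<n)
open import Data.Nat.ListAction using (sum)
open import Data.Nat.Properties
open import Data.Nat.Tactic.RingSolver using (solve-∀)
open import Data.Product as Product using (∃; _×_; _,_; proj₁; proj₂)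
import Data.Product.Properties as Product
open import Data.Rational as ℚ using (ℚ; 0ℚ; 1ℚ; toℚᵘ; fromℚᵘ)
import Data.Rational.Properties as ℚ
open import Data.Rational.Unnormalised as ℚᵘ using (mkℚᵘ; *≡*; *<*)
import Data.Rational.Unnormalised.Properties as ℚᵘ
open import Data.Sum as Sum using (_⊎_; inj₁; inj₂)
open import Data.Unit using (⊤; tt)
open import Data.Vec as Vec using (Vec; []; _∷_; lookup; head; toList)
open import Data.Vec.Membership.Propositional.Properties using (∈-lookup; ∈-toList⁺)
import Data.Vec.Properties as Vec
open import Function using (_∘_; id)
open import Function.Bundles using (Equivalence)
open import Level using (0ℓ)
open import Relation.Binary using (DecidableEquality)
open import Relation.Binary.PropositionalEquality
open import Relation.Nullary using (¬_; Dec; yes; no; contradiction)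
open import Relation.Nullary.Decidable using
  (⌊_⌋; toWitness; fromWitness; decidable-stable; map′; ¬?; T?; _×-dec_; _⊎-dec_; _→-dec_)
open import Relation.Unary using (Pred; Decidable)

-- The recursion defining `ℙ` is never solved: no fibre is counted in closed form. It is enough that
-- the number of samples with a prescribed restriction to dimension r+1 depends only on the
-- restriction to dimension r, and this follows from injections between fibres. The delicate step
-- leads from dimension 0 to 1, where the two colourings may differ; there no relation is visible
-- yet, because tuples of constant colour are forbidden. Samples keep the bits of inadmissible
-- tuples. Hence any pattern on finitely many points can be written into a sample regardless of its
-- colouring, patterns at different candidate points do not interfere, and all probabilities are
-- counts over one denominator, the number of samples. Independence appears only as an injection
-- that overwrites finitely many bits and remembers the old ones.

private variable
  A D       : Set
  j k l m n : ℕ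
  σ τ       : Vocabulary

-- Counting in lists without repetition

count : {P : Pred A 0ℓ} → Decidable P → List A → ℕ
count P? xs = length (filter P? xs)

length-≤-by-injection : (f : A → D) {xs : List A} {ys : List D} → Unique xs →
  (∀ {x} → x ∈ xs → f x ∈ ys) →
  (∀ {x y} → x ∈ xs → y ∈ xs → f x ≡ f y → x ≡ y) →
  length xs ≤ length ys
length-≤-by-injection f []                          into inj = z≤n
length-≤-by-injection f {x ∷ xs} {ys} (x∉xs ∷ xs!) into inj
  with as , bs , refl ← ∈-∃++ (into (here refl)) =
  subst (suc (length xs) ≤_) (sym (length-++-sucʳ as (f x) bs))
    (s≤s (length-≤-by-injection f xs! into′ λ x∈ y∈ → inj (there x∈) (there y∈)))
  where
  into′ : ∀ {z} → z ∈ xs → f z ∈ as ++ bs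
  into′ z∈xs with ∈-++⁻ as (into (there z∈xs))
  ... | inj₁ fz∈as         = ∈-++⁺ˡ fz∈as
  ... | inj₂ (there fz∈bs) = ∈-++⁺ʳ as fz∈bs
  ... | inj₂ (here fz≡fx)  =
    contradiction (inj (here refl) (there z∈xs) (sym fz≡fx)) (All.lookup x∉xs z∈xs)

length-≤-by-inclusion : {xs ys : List A} → Unique xs → (∀ {x} → x ∈ xs → x ∈ ys) →
  length xs ≤ length ys
length-≤-by-inclusion xs! into = length-≤-by-injection id xs! into λ _ _ → id

count-cong : {P Q : Pred A 0ℓ} (P? : Decidable P) (Q? : Decidable Q) →
  (∀ {x} → P x → Q x) → (∀ {x} → Q x → P x) → ∀ xs → count P? xs ≡ count Q? xs
count-cong P? Q? P⇒Q Q⇒P xs = cong length (filter-≐ P? Q? (P⇒Q , Q⇒P) xs)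

count-+-count-¬ : {P : Pred A 0ℓ} (P? : Decidable P) (xs : List A) →
  count P? xs + count (¬? ∘ P?) xs ≡ length xs
count-+-count-¬ P? []       = refl
count-+-count-¬ P? (x ∷ xs) with P? x
... | yes _ = cong suc (count-+-count-¬ P? xs)
... | no  _ = trans (+-suc (count P? xs) _) (cong suc (count-+-count-¬ P? xs))

count-⊎ : {P Q R : Pred A 0ℓ} (P? : Decidable P) (Q? : Decidable Q) (R? : Decidable R) →
  (∀ {x} → P x → ¬ Q x) → (∀ {x} → P x → R x) → (∀ {x} → Q x → R x) →
  (∀ {x} → R x → P x ⊎ Q x) →
  ∀ xs → count R? xs ≡ count P? xs + count Q? xs
count-⊎ P? Q? R? disj P⇒R Q⇒R R⇒ [] = refl
count-⊎ P? Q? R? disj P⇒R Q⇒R R⇒ (x ∷ xs)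
  with ih ← count-⊎ P? Q? R? disj P⇒R Q⇒R R⇒ xs | P? x | Q? x | R? x
... | yes p | yes q | _     = contradiction q (disj p)
... | yes p | no  _ | yes _ = cong suc ih
... | no  _ | yes _ | yes _ = trans (cong suc ih) (sym (+-suc (count P? xs) _))
... | no  _ | no  _ | no  _ = ih
... | yes p | no  _ | no ¬r = contradiction (P⇒R p) ¬r
... | no  _ | yes q | no ¬r = contradiction (Q⇒R q) ¬r
... | no ¬p | no ¬q | yes r with R⇒ r
...   | inj₁ p = contradiction p ¬p
...   | inj₂ q = contradiction q ¬q

module _ (_≟_ : DecidableEquality D) (h : A → D) (xs : List A) where

  fibre : D → ℕ
  fibre z = count (λ x → h x ≟ z) xs

  -- Double counting along `h`. It serves twice: to split the samples over a restriction according
  -- to the next dimension, and to add up the measure of a set of structures.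
  sum-of-fibres : {P : Pred A 0ℓ} {Z : List D} → Unique Z → (P? : Decidable P) →
    (∀ {x} → P x → h x ∈ Z) → (∀ {x} → h x ∈ Z → P x) →
    sum (map fibre Z) ≡ count P? xs
  sum-of-fibres {Z = []} _ P? P⇒ ⇒P =
    sym (cong length (filter-none P? (All.universal (λ _ Px → ¬Any[] (P⇒ Px)) xs)))
  sum-of-fibres {P = P} {Z = z ∷ Z} (z∉Z ∷ Z!) P? P⇒ ⇒P = begin
    fibre z + sum (map fibre Z)  ≡⟨ cong (fibre z +_) (sum-of-fibres Z! h∈Z? id id) ⟩
    fibre z + count h∈Z? xs        ≡⟨ sym (count-⊎ (λ x → h x ≟ z) h∈Z? P?
                                      (λ { refl hx∈Z → All.lookup z∉Z hx∈Z refl })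
                                      (⇒P ∘ here) (⇒P ∘ there) (uncons ∘ P⇒) xs) ⟩
    count P? xs                  ∎
    where
    open ≡-Reasoning
    open import Data.List.Membership.DecPropositional _≟_ using (_∈?_)
    h∈Z? : Decidable λ x → h x ∈ Z
    h∈Z? x = h x ∈? Z
    uncons : ∀ {b} → b ∈ z ∷ Z → (b ≡ z) ⊎ (b ∈ Z)
    uncons (here eq)  = inj₁ eq
    uncons (there b∈) = inj₂ b∈

sum-map-const : (f : A → ℕ) {k : ℕ} (xs : List A) → (∀ {x} → x ∈ xs → f x ≡ k) →
  sum (map f xs) ≡ length xs * k
sum-map-const f []       fx≡k = refl
sum-map-const f (x ∷ xs) fx≡k = cong₂ _+_ (fx≡k (here refl)) (sum-map-const f xs (fx≡k ∘ there))

length-cartesianProductWith : {C : Set} (f : A → D → C) (xs : List A) (ys : List D) →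
  length (cartesianProductWith f xs ys) ≡ length xs * length ys
length-cartesianProductWith f []       ys = refl
length-cartesianProductWith f (x ∷ xs) ys = begin
  length (map (f x) ys ++ cartesianProductWith f xs ys)
    ≡⟨ length-++ (map (f x) ys) ⟩
  length (map (f x) ys) + length (cartesianProductWith f xs ys)
    ≡⟨ cong₂ _+_ (length-map (f x) ys) (length-cartesianProductWith f xs ys) ⟩
  length ys + length xs * length ys ∎
  where open ≡-Reasoning

-- The union bound: if each of at most L events has a share of at most 1/(K L) of W, their union has
-- a share of at most 1/K.
length-concatMap-≤ : (K L W : ℕ) (f : A → List D) (xs : List A) → length xs ≤ L →
  (∀ {x} → x ∈ xs → K * L * length (f x) ≤ W) → K * length (concatMap f xs) ≤ W
length-concatMap-≤ K L       W f []             _    bound = subst (_≤ W) (sym (*-zeroʳ K)) z≤n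
length-concatMap-≤ K (suc l) W f xs@(_ ∷ _) len≤ bound = *-cancelˡ-≤ (suc l) (begin
  suc l * (K * length (concatMap f xs))  ≡⟨ sym (*-assoc (suc l) K _) ⟩
  suc l * K * length (concatMap f xs)    ≡⟨ cong (_* length (concatMap f xs)) (*-comm (suc l) K) ⟩
  K * suc l * length (concatMap f xs)    ≤⟨ total xs bound ⟩
  length xs * W                          ≤⟨ *-monoˡ-≤ W len≤ ⟩
  suc l * W                              ∎)
  where
  open ≤-Reasoning
  total : ∀ ys → (∀ {y} → y ∈ ys → K * suc l * length (f y) ≤ W) →
    K * suc l * length (concatMap f ys) ≤ length ys * W
  total []       _  = ≤-reflexive (*-zeroʳ (K * suc l))
  total (y ∷ ys) b≤ = begin
    K * suc l * length (f y ++ concatMap f ys)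
      ≡⟨ cong (K * suc l *_) (length-++ (f y)) ⟩
    K * suc l * (length (f y) + length (concatMap f ys))
      ≡⟨ *-distribˡ-+ (K * suc l) (length (f y)) _ ⟩
    K * suc l * length (f y) + K * suc l * length (concatMap f ys)
      ≤⟨ +-mono-≤ (b≤ (here refl)) (total ys (b≤ ∘ there)) ⟩
    W + length ys * W ∎

T-ext : ∀ {a b} → (T a → T b) → (T b → T a) → a ≡ b
T-ext {false} {false} _ _ = refl
T-ext {false} {true}  _ g = contradiction (g tt) id
T-ext {true}  {false} f _ = contradiction (f tt) id
T-ext {true}  {true}  _ _ = refl

-- Structures as families of bits

vec-ext : {u v : Vec A n} → (∀ i → lookup u i ≡ lookup v i) → u ≡ v
vec-ext {u = u} {v} eq =
  trans (sym (Vec.tabulate∘lookup u)) (trans (Vec.tabulate-cong eq) (Vec.tabulate∘lookup v))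

tabulate-at : (f : Vec (Fin n) m → Bool) (as : Vec (Fin n) m) → tabulate f at as ≡ f as
tabulate-at f []       = refl
tabulate-at f (a ∷ as) =
  trans (cong (_at as) (Vec.lookup∘tabulate (λ b → tabulate (λ bs → f (b ∷ bs))) a))
        (tabulate-at (λ bs → f (a ∷ bs)) as)

rel-ext : {r s : Rel n m} → (∀ as → r at as ≡ s at as) → r ≡ s
rel-ext {m = zero}  eq = eq []
rel-ext {m = suc m} eq = vec-ext λ a → rel-ext λ as → eq (a ∷ as)

bit : Structure τ n → m ∈ τ → Vec (Fin n) m → Bool
bit M R as = All.lookup M R at as

build : (∀ {m} → m ∈ τ → Vec (Fin n) m → Bool) → Structure τ n
build f = All.tabulate λ R → tabulate (f R)

bit-build : (f : ∀ {m} → m ∈ τ → Vec (Fin n) m → Bool) (R : m ∈ τ) (as : Vec (Fin n) m) →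
  bit (build f) R as ≡ f R as
bit-build f (here refl) as = tabulate-at (f (here refl)) as
bit-build f (there R)   as = bit-build (λ R → f (there R)) R as

structure-ext : {M M′ : Structure τ n} →
  (∀ {m} (R : m ∈ τ) as → bit M R as ≡ bit M′ R as) → M ≡ M′
structure-ext {M = []}    {[]}     eq = refl
structure-ext {M = _ ∷ _} {_ ∷ _} eq =
  cong₂ _∷_ (rel-ext (eq (here refl))) (structure-ext λ R → eq (there R))

-- The enumerations are complete and without repetition

∈-vectors : {xs : List A} → (∀ x → x ∈ xs) → (v : Vec A n) → v ∈ vectors xs n
∈-vectors ∈xs []      = here refl
∈-vectors ∈xs (x ∷ v) = ∈-cartesianProductWith⁺ _∷_ (∈xs x) (∈-vectors ∈xs v)

vectors-! : {xs : List A} → Unique xs → ∀ n → Unique (vectors xs n)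
vectors-! xs! zero    = [] ∷ []
vectors-! xs! (suc n) =
  cartesianProductWith⁺ _∷_ (λ { refl → refl , refl }) xs! (vectors-! xs! n)

∈-relations : (r : Rel n m) → r ∈ relations n m
∈-relations {m = zero}  true  = here refl
∈-relations {m = zero}  false = there (here refl)
∈-relations {m = suc m} r     = ∈-vectors ∈-relations r

relations-! : ∀ n m → Unique (relations n m)
relations-! n zero    = ((λ ()) ∷ []) ∷ [] ∷ []
relations-! n (suc m) = vectors-! (relations-! n m) n

∈-structures : (M : Structure τ n) → M ∈ structures τ n
∈-structures []      = here refl
∈-structures (r ∷ M) = ∈-cartesianProductWith⁺ _∷_ (∈-relations r) (∈-structures M)

structures-! : ∀ τ n → Unique (structures τ n)
structures-! []      n = [] ∷ []
structures-! (m ∷ τ) n =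
  cartesianProductWith⁺ _∷_ (λ { refl → refl , refl }) (relations-! n m) (structures-! τ n)

-- Restriction to tuples with few distinct entries

distinct≤length : (as : Vec (Fin n) m) → distinct as ≤ m
distinct≤length as =
  ≤-trans (length-deduplicate Fin._≟_ (toList as)) (≤-reflexive (Vec.length-toList as))

distinct≤1⇒constant : (as : Vec (Fin n) m) → distinct as ≤ 1 →
  ∀ i j → lookup as i ≡ lookup as j
distinct≤1⇒constant as d≤1 i j = singleton d≤1 (entry i) (entry j)
  where
  entry : ∀ i → lookup as i ∈ deduplicate Fin._≟_ (toList as)
  entry i = ∈-deduplicate⁺ Fin._≟_ (∈-toList⁺ (∈-lookup i as))
  singleton : {x y : A} {zs : List A} → length zs ≤ 1 → x ∈ zs → y ∈ zs → x ≡ y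
  singleton {zs = _ ∷ []}     _        (here refl) (here refl) = refl
  singleton {zs = _ ∷ _ ∷ _} (s≤s ()) _           _

bit-↾ : (M : Structure τ n) (d : ℕ) (R : m ∈ τ) (as : Vec (Fin n) m) →
  bit (M ↾ d) R as ≡ bit M R as ∧ (distinct as ≤ᵇ d)
bit-↾ M d R as =
  trans (cong (_at as) (lookup-map M R)) (tabulate-at _ as)

T-true : ∀ {b} → T b → b ≡ true
T-true {true} _ = refl

≤ᵇ-true : ∀ {a b} → a ≤ b → (a ≤ᵇ b) ≡ true
≤ᵇ-true = T-true ∘ ≤⇒≤ᵇ

↾-suc-↾ : (M : Structure τ n) (r : ℕ) → (M ↾ suc r) ↾ r ≡ M ↾ r
↾-suc-↾ M r = structure-ext λ R as → begin
  bit ((M ↾ suc r) ↾ r) R as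
    ≡⟨ trans (bit-↾ (M ↾ suc r) r R as) (cong (_∧ _) (bit-↾ M (suc r) R as)) ⟩
  (bit M R as ∧ (distinct as ≤ᵇ suc r)) ∧ (distinct as ≤ᵇ r)
    ≡⟨ ∧-assoc (bit M R as) _ _ ⟩
  bit M R as ∧ ((distinct as ≤ᵇ suc r) ∧ (distinct as ≤ᵇ r))
    ≡⟨ cong (bit M R as ∧_) (absorb (distinct as)) ⟩
  bit M R as ∧ (distinct as ≤ᵇ r)
    ≡⟨ sym (bit-↾ M r R as) ⟩
  bit (M ↾ r) R as ∎
  where
  open ≡-Reasoning
  absorb : ∀ d → (d ≤ᵇ suc r) ∧ (d ≤ᵇ r) ≡ (d ≤ᵇ r)
  absorb d = T-ext (proj₂ ∘ Equivalence.to T-∧)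
    λ d≤r → Equivalence.from T-∧ (≤⇒≤ᵇ (≤-trans (≤ᵇ⇒≤ d r d≤r) (n≤1+n r)) , d≤r)

↾-ρ : (M : Structure τ n) → M ↾ ρ τ ≡ M
↾-ρ {τ = τ} M = structure-ext λ R as → begin
  bit (M ↾ ρ τ) R as
    ≡⟨ bit-↾ M (ρ τ) R as ⟩
  bit M R as ∧ (distinct as ≤ᵇ ρ τ)
    ≡⟨ cong (bit M R as ∧_)
         (≤ᵇ-true (≤-trans (distinct≤length as) (All.lookup (xs≤max 0 τ) R))) ⟩
  bit M R as ∧ true
    ≡⟨ ∧-identityʳ _ ⟩
  bit M R as ∎
  where open ≡-Reasoning

-- The symbols of the coloured vocabulary

position : Fin k → 1 ∈ replicate k 1
position zero    = here refl
position (suc i) = there (position i)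

-- colourSymbol is defined through a local function that cannot be named from outside;
-- checking colourSymbol-suc makes unification identify colourPosition with that function.
mutual
  colourPosition : (l : ℕ) (σ : Vocabulary) → Fin l → ∀ {k} → Fin k → 1 ∈ replicate k 1
  colourPosition = _

  colourSymbol-suc : (i : Fin l) →
    colourSymbol {σ = σ} (suc i) ≡ there (∈-++⁺ˡ (colourPosition (suc l) σ (suc i) i))
  colourSymbol-suc {l} i with suc l | Fin.suc i
  ... | _ | _ = refl

colourPosition≡position : (i₀ : Fin l) (i : Fin k) → colourPosition l σ i₀ i ≡ position i
colourPosition≡position         i₀ zero    = refl
colourPosition≡position {σ = σ} i₀ (suc i) = cong there (colourPosition≡position {σ = σ} i₀ i)

colourSymbol≡position : (i : Fin l) → colourSymbol {σ = σ} i ≡ ∈-++⁺ˡ (position i)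
colourSymbol≡position {σ = σ} i = cong ∈-++⁺ˡ (colourPosition≡position {σ = σ} i i)

lookup-++⁺-∈-++⁺ˡ : {P : ℕ → Set} {xs ys : List ℕ} (ps : All P xs) (qs : All P ys) (x∈ : m ∈ xs) →
  All.lookup (++⁺ ps qs) (∈-++⁺ˡ x∈) ≡ All.lookup ps x∈
lookup-++⁺-∈-++⁺ˡ (p ∷ ps) qs (here refl) = refl
lookup-++⁺-∈-++⁺ˡ (p ∷ ps) qs (there x∈)  = lookup-++⁺-∈-++⁺ˡ ps qs x∈

lookup-++⁺-∈-++⁺ʳ : {P : ℕ → Set} {xs ys : List ℕ} (ps : All P xs) (qs : All P ys) (x∈ : m ∈ ys) →
  All.lookup (++⁺ ps qs) (∈-++⁺ʳ xs x∈) ≡ All.lookup qs x∈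
lookup-++⁺-∈-++⁺ʳ []       qs x∈ = refl
lookup-++⁺-∈-++⁺ʳ (p ∷ ps) qs x∈ = lookup-++⁺-∈-++⁺ʳ ps qs x∈

bit-reduct : ∀ l (M : Structure (Coloured l σ) n) (R : m ∈ σ) (as : Vec (Fin n) m) →
  bit (reduct l M) R as ≡ bit M (relSymbol l R) as
bit-reduct zero    M       R as = refl
bit-reduct (suc l) (_ ∷ M) R as = bit-reduct l M R as

coloured-ext : {M M′ : Structure (Coloured l σ) n} →
  (∀ i a → bit M (colourSymbol i) (a ∷ []) ≡ bit M′ (colourSymbol i) (a ∷ [])) →
  (∀ {m} (R : m ∈ σ) as → bit M (relSymbol l R) as ≡ bit M′ (relSymbol l R) as) →
  M ≡ M′
coloured-ext {l} {σ} {n} {M} {M′} colours rels = go l M M′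
  (λ i a → subst (λ R → bit M R (a ∷ []) ≡ bit M′ R (a ∷ [])) (colourSymbol≡position i) (colours i a))
  rels
  where
  go : ∀ k (M M′ : Structure (Coloured k σ) n) →
    (∀ (i : Fin k) a → bit M (∈-++⁺ˡ (position i)) (a ∷ []) ≡ bit M′ (∈-++⁺ˡ (position i)) (a ∷ [])) →
    (∀ {m} (R : m ∈ σ) as → bit M (relSymbol k R) as ≡ bit M′ (relSymbol k R) as) → M ≡ M′
  go zero    M       M′        _ rels  = structure-ext rels
  go (suc k) (r ∷ M) (r′ ∷ M′) colours rels = cong₂ _∷_
    (rel-ext λ { (a ∷ []) → colours zero a }) (go k M M′ (colours ∘ suc) rels)

colourRelations : ∀ k → (Fin k → Fin n → Bool) → All (Rel n) (replicate k 1)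
colourRelations zero    p = []
colourRelations (suc k) p = Vec.tabulate (p zero) ∷ colourRelations k (p ∘ suc)

lookup-colourRelations : (p : Fin k → Fin n → Bool) (i : Fin k) (a : Fin n) →
  All.lookup (colourRelations k p) (position i) at (a ∷ []) ≡ p i a
lookup-colourRelations p zero    a = Vec.lookup∘tabulate (p zero) a
lookup-colourRelations p (suc i) a = lookup-colourRelations (p ∘ suc) i a

-- Ratios of natural numbers

-- The value at denominator zero is immaterial.
ratio : ℕ → ℕ → ℚ
ratio a zero    = 0ℚ
ratio a (suc w) = ℤ.+ a ℚ./ suc w

fromℚᵘ-homo-+ : ∀ p q → fromℚᵘ p ℚ.+ fromℚᵘ q ≡ fromℚᵘ (p ℚᵘ.+ q)
fromℚᵘ-homo-+ p q = ℚ.toℚᵘ-injective (begin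
  toℚᵘ (fromℚᵘ p ℚ.+ fromℚᵘ q)           ≈⟨ ℚ.toℚᵘ-homo-+ (fromℚᵘ p) (fromℚᵘ q) ⟩
  toℚᵘ (fromℚᵘ p) ℚᵘ.+ toℚᵘ (fromℚᵘ q)   ≈⟨ ℚᵘ.+-cong (ℚ.toℚᵘ-fromℚᵘ p) (ℚ.toℚᵘ-fromℚᵘ q) ⟩
  p ℚᵘ.+ q                               ≈⟨ ℚᵘ.≃-sym (ℚ.toℚᵘ-fromℚᵘ (p ℚᵘ.+ q)) ⟩
  toℚᵘ (fromℚᵘ (p ℚᵘ.+ q))               ∎)
  where open ℚᵘ.≃-Reasoning

fromℚᵘ-homo-* : ∀ p q → fromℚᵘ p ℚ.* fromℚᵘ q ≡ fromℚᵘ (p ℚᵘ.* q)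
fromℚᵘ-homo-* p q = ℚ.toℚᵘ-injective (begin
  toℚᵘ (fromℚᵘ p ℚ.* fromℚᵘ q)           ≈⟨ ℚ.toℚᵘ-homo-* (fromℚᵘ p) (fromℚᵘ q) ⟩
  toℚᵘ (fromℚᵘ p) ℚᵘ.* toℚᵘ (fromℚᵘ q)   ≈⟨ ℚᵘ.*-cong (ℚ.toℚᵘ-fromℚᵘ p) (ℚ.toℚᵘ-fromℚᵘ q) ⟩
  p ℚᵘ.* q                               ≈⟨ ℚᵘ.≃-sym (ℚ.toℚᵘ-fromℚᵘ (p ℚᵘ.* q)) ⟩
  toℚᵘ (fromℚᵘ (p ℚᵘ.* q))               ∎)
  where open ℚᵘ.≃-Reasoning

ratio-+ : ∀ a b W → ratio a W ℚ.+ ratio b W ≡ ratio (a + b) W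
ratio-+ a b zero    = refl
ratio-+ a b (suc w) =
  trans (fromℚᵘ-homo-+ p q) (ℚ.fromℚᵘ-cong {p ℚᵘ.+ q} {mkℚᵘ (ℤ.+ (a + b)) w} (*≡* (begin
    (ℤ.+ a ℤ.* ℤ.+ suc w ℤ.+ ℤ.+ b ℤ.* ℤ.+ suc w) ℤ.* ℤ.+ suc w
      ≡⟨ cong (ℤ._* ℤ.+ suc w) (sym (ℤ.*-distribʳ-+ (ℤ.+ suc w) (ℤ.+ a) (ℤ.+ b))) ⟩
    (ℤ.+ (a + b) ℤ.* ℤ.+ suc w) ℤ.* ℤ.+ suc w
      ≡⟨ ℤ.*-assoc (ℤ.+ (a + b)) (ℤ.+ suc w) (ℤ.+ suc w) ⟩
    ℤ.+ (a + b) ℤ.* (ℤ.+ suc w ℤ.* ℤ.+ suc w) ∎)))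
  where
  open ≡-Reasoning
  p = mkℚᵘ (ℤ.+ a) w
  q = mkℚᵘ (ℤ.+ b) w

-- The step of `ℙ` with the denominator held fixed: a fibre of size b splits into k fibres of equal
-- size a.
ratio-*-1/ : ∀ a {b} k W → 0 < k → k * a ≡ b → ratio b W ℚ.* 1/ k ≡ ratio a W
ratio-*-1/ a k       zero    0<k refl = ℚ.*-zeroˡ (1/ k)
ratio-*-1/ a (suc k) (suc w) 0<k refl =
  trans (fromℚᵘ-homo-* p q) (ℚ.fromℚᵘ-cong {p ℚᵘ.* q} {mkℚᵘ (ℤ.+ a) w} (*≡* (begin
    (ℤ.+ (suc k * a) ℤ.* ℤ.+ 1) ℤ.* ℤ.+ suc w
      ≡⟨ cong (ℤ._* ℤ.+ suc w) (ℤ.*-identityʳ (ℤ.+ (suc k * a))) ⟩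
    ℤ.+ (suc k * a) ℤ.* ℤ.+ suc w
      ≡⟨ sym (ℤ.pos-* (suc k * a) (suc w)) ⟩
    ℤ.+ (suc k * a * suc w)
      ≡⟨ cong ℤ.+_ (ℕ-rearrange (suc k) a (suc w)) ⟩
    ℤ.+ (a * (suc w * suc k))
      ≡⟨ ℤ.pos-* a (suc w * suc k) ⟩
    ℤ.+ a ℤ.* ℤ.+ (suc w * suc k) ∎)))
  where
  open ≡-Reasoning
  p = mkℚᵘ (ℤ.+ (suc k * a)) w
  q = mkℚᵘ (ℤ.+ 1) k
  ℕ-rearrange : ∀ k a w → k * a * w ≡ a * (w * k)
  ℕ-rearrange = solve-∀

1/≡ratio : ∀ a k {W} → 0 < W → k * a ≡ W → 1/ k ≡ ratio a W
1/≡ratio a zero    () refl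
1/≡ratio a (suc k) {suc w} _ eq = ℚ.fromℚᵘ-cong {mkℚᵘ (ℤ.+ 1) k} {mkℚᵘ (ℤ.+ a) w} (*≡* (begin
  ℤ.+ 1 ℤ.* ℤ.+ suc w  ≡⟨ ℤ.*-identityˡ (ℤ.+ suc w) ⟩
  ℤ.+ suc w            ≡⟨ cong ℤ.+_ (sym eq) ⟩
  ℤ.+ (suc k * a)      ≡⟨ cong ℤ.+_ (*-comm (suc k) a) ⟩
  ℤ.+ (a * suc k)      ≡⟨ ℤ.pos-* a (suc k) ⟩
  ℤ.+ a ℤ.* ℤ.+ suc k    ∎))
  where open ≡-Reasoning

ratio-0 : ∀ W → ratio 0 W ≡ 0ℚ
ratio-0 zero    = refl
ratio-0 (suc w) = ℚ.fromℚᵘ-cong {mkℚᵘ (ℤ.+ 0) w} {mkℚᵘ (ℤ.+ 0) 0} (*≡* refl)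

ratio-self : ∀ {W} → 0 < W → ratio W W ≡ 1ℚ
ratio-self {suc w} _ = ℚ.fromℚᵘ-cong {mkℚᵘ (ℤ.+ suc w) w} {mkℚᵘ (ℤ.+ 1) 0} (*≡* (ℤ.*-comm (ℤ.+ suc w) (ℤ.+ 1)))

∣ratio∣ : ∀ a W → ℚ.∣ ratio a W ∣ ≡ ratio a W
∣ratio∣ a zero    = refl
∣ratio∣ a (suc w) = ℚ.0≤p⇒∣p∣≡p (ℚ.nonNegative⁻¹ (ℤ.+ a ℚ./ suc w) {{ℚ.normalize-nonNeg a (suc w)}})

foldr-ratio : (W : ℕ) (g : A → ℚ) (f : A → ℕ) (xs : List A) →
  (∀ {x} → x ∈ xs → g x ≡ ratio (f x) W) → foldr ℚ._+_ 0ℚ (map g xs) ≡ ratio (sum (map f xs)) W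
foldr-ratio W g f []       eq = sym (ratio-0 W)
foldr-ratio W g f (x ∷ xs) eq =
  trans (cong₂ ℚ._+_ (eq (here refl)) (foldr-ratio W g f xs (eq ∘ there))) (ratio-+ (f x) _ W)

-- The quotient of `a n` by `W n` tends to 0, with denominators cleared.
Negligible : (ℕ → ℕ) → (ℕ → ℕ) → Set
Negligible a W = ∀ K → ∃ λ N → ∀ n → n ≥ N → K * a n ≤ W n

module _ {a W : ℕ → ℕ} (0<W : ∀ n → 0 < W n) (negl : Negligible a W) where

  eventually-ratio<ε : ∀ ε → 0ℚ ℚ.< ε → ∃ λ N → ∀ n → n ≥ N → ratio (a n) (W n) ℚ.< ε
  eventually-ratio<ε ε@(ℚ.mkℚ +[1+ p ] d _) _ =
    -- Here ε is (p+1)/(d+1), hence at least 1/(d+1); a share of at most 1/(d+2) is strictly below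
    -- it.
    proj₁ (negl (2 + d)) , λ n n≥N → small (0<W n) (proj₂ (negl (2 + d)) n n≥N)
    where
    open ≤-Reasoning
    below : ∀ x w → (2 + d) * x ≤ suc w → x * suc d < suc w
    below zero    w _ = s≤s z≤n
    below (suc x) w h = begin-strict
      suc x * suc d              <⟨ *-monoʳ-< (suc x) (n<1+n (suc d)) ⟩
      suc x * (2 + d)          ≡⟨ *-comm (suc x) (2 + d) ⟩
      (2 + d) * suc x          ≤⟨ h ⟩
      suc w                        ∎
    small : ∀ {x V} → 0 < V → (2 + d) * x ≤ V → ratio x V ℚ.< ε
    small {x} {suc w} _ h = ℚ.toℚᵘ-cancel-< (ℚᵘ.<-respˡ-≃
      (ℚᵘ.≃-sym (ℚ.toℚᵘ-fromℚᵘ (mkℚᵘ (ℤ.+ x) w)))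
      (*<* (subst₂ ℤ._<_ (ℤ.pos-* x (suc d)) (ℤ.pos-* (suc p) (suc w))
        (ℤ.+<+ (<-≤-trans (below x w h) (m≤m+n (suc w) (p * suc w)))))))
  eventually-ratio<ε (ℚ.mkℚ (ℤ.+ zero) d _) (ℚ.*<* (ℤ.+<+ ()))
  eventually-ratio<ε (ℚ.mkℚ (ℤ.-[1+ _ ]) d _) (ℚ.*<* ())

  ratio⟶0 : {u : ℕ → ℚ} → (∀ n → u n ≡ ratio (a n) (W n)) → u ⟶ 0ℚ
  ratio⟶0 {u} u≡ ε 0<ε with N , below ← eventually-ratio<ε ε 0<ε =
    N , λ n n≥N → subst (ℚ._< ε) (sym (eq n)) (below n n≥N)
    where
    eq : ∀ n → ℚ.∣ u n ℚ.- 0ℚ ∣ ≡ ratio (a n) (W n)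
    eq n = trans (cong ℚ.∣_∣ (trans (ℚ.+-identityʳ (u n)) (u≡ n))) (∣ratio∣ (a n) (W n))

  ratio⟶1 : {b : ℕ → ℕ} {u : ℕ → ℚ} → (∀ n → b n + a n ≡ W n) →
    (∀ n → u n ≡ ratio (b n) (W n)) → u ⟶ 1ℚ
  ratio⟶1 {b} {u} total u≡ ε 0<ε with N , below ← eventually-ratio<ε ε 0<ε =
    N , λ n n≥N → subst (ℚ._< ε) (sym (eq n)) (below n n≥N)
    where
    open ≡-Reasoning
    complement : ∀ n → u n ℚ.- 1ℚ ≡ ℚ.- ratio (a n) (W n)
    complement n = begin
      u n ℚ.- 1ℚ
        ≡⟨ cong₂ ℚ._-_ (u≡ n) (sym (ratio-self (0<W n))) ⟩
      ratio (b n) (W n) ℚ.- ratio (W n) (W n)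
        ≡⟨ cong (λ c → ratio (b n) (W n) ℚ.- ratio c (W n)) (sym (total n)) ⟩
      ratio (b n) (W n) ℚ.- ratio (b n + a n) (W n)
        ≡⟨ cong (λ q → ratio (b n) (W n) ℚ.- q) (sym (ratio-+ (b n) (a n) (W n))) ⟩
      ratio (b n) (W n) ℚ.- (ratio (b n) (W n) ℚ.+ ratio (a n) (W n))
        ≡⟨ cong (λ q → ratio (b n) (W n) ℚ.+ q) (ℚ.neg-distrib-+ (ratio (b n) (W n)) _) ⟩
      ratio (b n) (W n) ℚ.+ (ℚ.- ratio (b n) (W n) ℚ.+ ℚ.- ratio (a n) (W n))
        ≡⟨ sym (ℚ.+-assoc (ratio (b n) (W n)) _ _) ⟩
      ratio (b n) (W n) ℚ.- ratio (b n) (W n) ℚ.+ ℚ.- ratio (a n) (W n)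
        ≡⟨ cong (ℚ._+ ℚ.- ratio (a n) (W n)) (ℚ.+-inverseʳ (ratio (b n) (W n))) ⟩
      0ℚ ℚ.+ ℚ.- ratio (a n) (W n)
        ≡⟨ ℚ.+-identityˡ _ ⟩
      ℚ.- ratio (a n) (W n) ∎
    eq : ∀ n → ℚ.∣ u n ℚ.- 1ℚ ∣ ≡ ratio (a n) (W n)
    eq n = trans (cong ℚ.∣_∣ (complement n))
      (trans (ℚ.∣-p∣≡∣p∣ (ratio (a n) (W n))) (∣ratio∣ (a n) (W n)))

-- Uniform samples and the dimension conditional measure

-- A sample is a colouring together with arbitrary relations; deleting the tuples that the
-- colouring forbids turns uniform samples into the dimension conditional measure.
Sample : ℕ → Vocabulary → ℕ → Set
Sample l σ n = Vec (Fin l) n × Structure σ n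

samples : ∀ l σ n → List (Sample l σ n)
samples l σ n = cartesianProduct (vectors (allFin l) n) (structures σ n)

∈-samples : (ω : Sample l σ n) → ω ∈ samples l σ n
∈-samples (c , X) = ∈-cartesianProduct⁺ (∈-vectors ∈-allFin c) (∈-structures X)

samples-! : ∀ l σ n → Unique (samples l σ n)
samples-! l σ n = cartesianProduct⁺ (vectors-! (allFin⁺ l) n) (structures-! σ n)

0<length : {A : Set} {x : A} {xs : List A} → x ∈ xs → 0 < length xs
0<length (here _)  = s≤s z≤n
0<length (there _) = s≤s z≤n

Constant : {A : Set} → Vec A m → Set
Constant v = ∀ i j → lookup v i ≡ lookup v j

-- Adding X₀ and X₁ modulo 2 carries the relations agreeing with X₀ to those agreeing with X₁.
shift : (X₀ X₁ X : Structure σ n) → Structure σ n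
shift X₀ X₁ X = build λ R as → bit X R as xor (bit X₀ R as xor bit X₁ R as)

xor-shift : ∀ x₁ x → x xor (x xor x₁) ≡ x₁
xor-shift false false = refl
xor-shift false true  = refl
xor-shift true  false = refl
xor-shift true  true  = refl

xor-cancelʳ : ∀ x y z → x xor z ≡ y xor z → x ≡ y
xor-cancelʳ false false z     eq = refl
xor-cancelʳ true  true  z     eq = refl
xor-cancelʳ false true  false ()
xor-cancelʳ false true  true  ()
xor-cancelʳ true  false false ()
xor-cancelʳ true  false true  ()

-- The bit b says whether a tuple is both allowed and visible at the current dimension. Only on such
-- tuples does the shift have to carry agreement with x₀ into agreement with x₁.
∧-shift : ∀ x x₀ x₁ b → x ∧ b ≡ x₀ ∧ b → (x xor (x₀ xor x₁)) ∧ b ≡ x₁ ∧ b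
∧-shift x x₀ x₁ false _  = trans (∧-zeroʳ _) (sym (∧-zeroʳ x₁))
∧-shift x x₀ x₁ true  eq
  with refl ← trans (sym (∧-identityʳ x)) (trans eq (∧-identityʳ x₀)) = cong (_∧ true) (xor-shift x₁ x)

shift-injective : (X₀ X₁ X X′ : Structure σ n) → shift X₀ X₁ X ≡ shift X₀ X₁ X′ → X ≡ X′
shift-injective X₀ X₁ X X′ eq = structure-ext λ R as →
  xor-cancelʳ (bit X R as) (bit X′ R as) (bit X₀ R as xor bit X₁ R as)
    (trans (sym (bit-build _ R as)) (trans (cong (λ Y → bit Y R as) eq) (bit-build _ R as)))

-- Both classes fit one scheme because their conditions on a tuple depend only on the colours of its
-- entries, which is all that `allowed` is given.
module Admissible {l : ℕ} {σ : Vocabulary} (allowed : ∀ {m} → Vec (Fin l) m → Bool) where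

  admit : Sample l σ n → Structure σ n
  admit (c , X) = build λ R as → bit X R as ∧ allowed (Vec.map (lookup c) as)

  colouring : Vec (Fin l) n → All (Rel n) (replicate l 1)
  colouring c = colourRelations l λ i a → ⌊ lookup c a Fin.≟ i ⌋

  expand : Sample l σ n → Structure (Coloured l σ) n
  expand ω = ++⁺ (colouring (proj₁ ω)) (admit ω)

  bit-expand-colour : (ω : Sample l σ n) (i : Fin l) (a : Fin n) →
    bit (expand ω) (colourSymbol i) (a ∷ []) ≡ ⌊ lookup (proj₁ ω) a Fin.≟ i ⌋
  bit-expand-colour ω i a = begin
    bit (expand ω) (colourSymbol i) (a ∷ [])
      ≡⟨ cong (λ R → bit (expand ω) R (a ∷ [])) (colourSymbol≡position i) ⟩
    bit (expand ω) (∈-++⁺ˡ (position i)) (a ∷ [])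
      ≡⟨ cong (_at (a ∷ [])) (lookup-++⁺-∈-++⁺ˡ (colouring (proj₁ ω)) (admit ω) (position i)) ⟩
    All.lookup (colouring (proj₁ ω)) (position i) at (a ∷ [])
      ≡⟨ lookup-colourRelations (λ i a → ⌊ lookup (proj₁ ω) a Fin.≟ i ⌋) i a ⟩
    ⌊ lookup (proj₁ ω) a Fin.≟ i ⌋ ∎
    where open ≡-Reasoning

  bit-expand-rel : (ω : Sample l σ n) (R : m ∈ σ) (as : Vec (Fin n) m) →
    bit (expand ω) (relSymbol l R) as
      ≡ bit (proj₂ ω) R as ∧ allowed (Vec.map (lookup (proj₁ ω)) as)
  bit-expand-rel ω R as = trans
    (cong (_at as) (lookup-++⁺-∈-++⁺ʳ (colouring (proj₁ ω)) (admit ω) R)) (bit-build _ R as)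

  reduct-expand : (ω : Sample l σ n) → reduct l (expand ω) ≡ admit ω
  reduct-expand ω = structure-ext λ R as → trans (bit-reduct l (expand ω) R as)
    (cong (_at as) (lookup-++⁺-∈-++⁺ʳ (colouring (proj₁ ω)) (admit ω) R))

  -- A colour atom has exactly one distinct entry, so the colouring is visible from dimension 1 on,
  -- but not at dimension 0.
  expand-↾-suc-colours : (ω ω′ : Sample l σ n) (r : ℕ) →
    expand ω ↾ suc r ≡ expand ω′ ↾ suc r → proj₁ ω ≡ proj₁ ω′
  expand-↾-suc-colours ω ω′ r eq = vec-ext λ a → toWitness (subst T (same a) (fromWitness refl))
    where
    open ≡-Reasoning
    colour-bit : ∀ ω i a →
      bit (expand ω ↾ suc r) (colourSymbol i) (a ∷ []) ≡ ⌊ lookup (proj₁ ω) a Fin.≟ i ⌋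
    colour-bit ω i a = begin
      bit (expand ω ↾ suc r) (colourSymbol i) (a ∷ [])
        ≡⟨ bit-↾ (expand ω) (suc r) (colourSymbol i) (a ∷ []) ⟩
      bit (expand ω) (colourSymbol i) (a ∷ []) ∧ true
        ≡⟨ ∧-identityʳ _ ⟩
      bit (expand ω) (colourSymbol i) (a ∷ [])
        ≡⟨ bit-expand-colour ω i a ⟩
      ⌊ lookup (proj₁ ω) a Fin.≟ i ⌋ ∎
    same : ∀ a → ⌊ lookup (proj₁ ω′) a Fin.≟ lookup (proj₁ ω′) a ⌋
               ≡ ⌊ lookup (proj₁ ω) a Fin.≟ lookup (proj₁ ω′) a ⌋
    same a = let i = lookup (proj₁ ω′) a in
      trans (sym (colour-bit ω′ i a))
        (trans (cong (λ M → bit M (colourSymbol i) (a ∷ [])) (sym eq)) (colour-bit ω i a))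

  module Measure
    (constant-forbidden : ∀ {m} → m ∈ σ → (cs : Vec (Fin l) m) → Constant cs → ¬ T (allowed cs))
    {n : ℕ} (X : List (Structure (Coloured l σ) n)) (X! : Unique X)
    (expand-∈ : ∀ ω → expand ω ∈ X) (∈-expand : ∀ {M} → M ∈ X → ∃ λ ω → expand ω ≡ M)
    where

    Ω : List (Sample l σ n)
    Ω = samples l σ n

    restricted : ℕ → Sample l σ n → Structure (Coloured l σ) n
    restricted r ω = expand ω ↾ r

    -- Up to the denominator `length Ω`, this will turn out to be `ℙ X r`.
    fibreSize : ℕ → Structure (Coloured l σ) n → ℕ
    fibreSize r = fibre _≟ˢ_ (restricted r) Ω

    -- Such a tuple has constant colours under every colouring. Dimension 1 therefore adds the
    -- colours and no relation.
    few-distinct-forbidden : (c : Vec (Fin l) n) (R : m ∈ σ) (as : Vec (Fin n) m) →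
      distinct as ≤ 1 → ¬ T (allowed (Vec.map (lookup c) as))
    few-distinct-forbidden c R as d≤1 = constant-forbidden R (Vec.map (lookup c) as) λ i j →
      trans (Vec.lookup-map i (lookup c) as)
        (trans (cong (lookup c) (distinct≤1⇒constant as d≤1 i j)) (sym (Vec.lookup-map j (lookup c) as)))

    -- Dimension 0 shows nothing: it hides every colour atom, and a tuple of the other symbols that
    -- is short enough to be visible is forbidden. So `X ↾ᴸ 0` has a single member.
    restricted-0 : ∀ ω ω′ → restricted 0 ω ≡ restricted 0 ω′
    restricted-0 ω ω′ = coloured-ext
      (λ i a → trans (bit-↾ (expand ω) 0 (colourSymbol i) (a ∷ []))
        (trans (∧-zeroʳ _) (sym (trans (bit-↾ (expand ω′) 0 (colourSymbol i) (a ∷ [])) (∧-zeroʳ _)))))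
      λ R as → T-ext (λ t → contradiction t (empty ω R as)) (λ t → contradiction t (empty ω′ R as))
      where
      empty : ∀ ω {m} (R : m ∈ σ) as → ¬ T (bit (restricted 0 ω) (relSymbol l R) as)
      empty ω@(c , _) R as t
        with b , d ← Equivalence.to T-∧ (subst T (bit-↾ (expand ω) 0 (relSymbol l R) as) t)
        with _ , ok ← Equivalence.to T-∧ (subst T (bit-expand-rel ω R as) b) =
        few-distinct-forbidden c R as (≤-step₀ (≤ᵇ⇒≤ (distinct as) 0 d)) ok
        where
        ≤-step₀ : ∀ {d} → d ≤ 0 → d ≤ 1
        ≤-step₀ z≤n = z≤n

    -- The map `f` installs the colouring c₁ and shifts the relations. It loses no information on
    -- the fibre of ω₀, where the colouring is always c₀. The hypothesis is symmetric in ω₀ and ω₁,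
    -- so this inequality yields equality.
    fibreSize-suc-≤ : ∀ r ω₀ ω₁ → restricted r ω₀ ≡ restricted r ω₁ →
      fibreSize (suc r) (restricted (suc r) ω₀) ≤ fibreSize (suc r) (restricted (suc r) ω₁)
    fibreSize-suc-≤ r ω₀@(c₀ , X₀) ω₁@(c₁ , X₁) agree =
      length-≤-by-injection f (filter⁺ (λ ω → restricted (suc r) ω ≟ˢ _) (samples-! l σ n))
        (λ {ω} ω∈ → ∈-filter⁺ (λ ω → restricted (suc r) ω ≟ˢ _) (∈-samples (f ω))
          (into ω (proj₂ (∈-filter⁻ (λ ω → restricted (suc r) ω ≟ˢ _) {xs = Ω} ω∈))))
        (λ {ω} {ω′} ω∈ ω′∈ eq →
          injective ω ω′ (proj₂ (∈-filter⁻ (λ ω → restricted (suc r) ω ≟ˢ _) {xs = Ω} ω∈))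
            (proj₂ (∈-filter⁻ (λ ω → restricted (suc r) ω ≟ˢ _) {xs = Ω} ω′∈)) eq)
      where
      f : Sample l σ n → Sample l σ n
      f (_ , X) = c₁ , shift X₀ X₁ X

      injective : ∀ ω ω′ → restricted (suc r) ω ≡ restricted (suc r) ω₀ →
        restricted (suc r) ω′ ≡ restricted (suc r) ω₀ → f ω ≡ f ω′ → ω ≡ ω′
      injective ω@(c , X) ω′@(c′ , X′) e e′ fω≡fω′ = cong₂ _,_
        (trans (expand-↾-suc-colours ω ω₀ r e) (sym (expand-↾-suc-colours ω′ ω₀ r e′)))
        (shift-injective X₀ X₁ X X′ (cong proj₂ fω≡fω′))

      rel-bit : ∀ ω {m} (R : m ∈ σ) as →
        bit (restricted (suc r) ω) (relSymbol l R) as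
          ≡ bit (proj₂ ω) R as ∧ (allowed (Vec.map (lookup (proj₁ ω)) as) ∧ (distinct as ≤ᵇ suc r))
      rel-bit ω R as = trans (bit-↾ (expand ω) (suc r) (relSymbol l R) as)
        (trans (cong (_∧ _) (bit-expand-rel ω R as)) (∧-assoc (bit (proj₂ ω) R as) _ _))

      into : ∀ ω → restricted (suc r) ω ≡ restricted (suc r) ω₀ →
        restricted (suc r) (f ω) ≡ restricted (suc r) ω₁
      into ω@(c , X) e = coloured-ext
        (λ i a → trans (bit-↾ (expand (f ω)) (suc r) (colourSymbol i) (a ∷ []))
          (trans (cong (_∧ _) (trans (bit-expand-colour (f ω) i a) (sym (bit-expand-colour ω₁ i a))))
            (sym (bit-↾ (expand ω₁) (suc r) (colourSymbol i) (a ∷ [])))))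
        λ R as → trans (rel-bit (f ω) R as)
          (trans (cong (_∧ _) (bit-build _ R as)) (trans (shifted r agree R as (old R as)) (sym (rel-bit ω₁ R as))))
        where
        c≡c₀ : c ≡ c₀
        c≡c₀ = expand-↾-suc-colours ω ω₀ r e

        old : ∀ {m} (R : m ∈ σ) as →
          let b = allowed (Vec.map (lookup c₀) as) ∧ (distinct as ≤ᵇ suc r) in
          bit X R as ∧ b ≡ bit X₀ R as ∧ b
        old R as = trans
          (cong (λ c → bit X R as ∧ (allowed (Vec.map (lookup c) as) ∧ (distinct as ≤ᵇ suc r))) (sym c≡c₀))
          (trans (sym (rel-bit ω R as))
            (trans (cong (λ M → bit M (relSymbol l R) as) e) (rel-bit ω₀ R as)))

        -- The dimension is quantified afresh to allow a case split. At 0 the colourings c₀ and c₁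
        -- may differ, but every tuple visible at dimension 1 is forbidden, so both sides are false.
        -- At a successor, agreement forces c₀ and c₁ to coincide.
        shifted : ∀ r → restricted r ω₀ ≡ restricted r ω₁ → ∀ {m} (R : m ∈ σ) as →
          (let b = allowed (Vec.map (lookup c₀) as) ∧ (distinct as ≤ᵇ suc r) in
           bit X R as ∧ b ≡ bit X₀ R as ∧ b) →
          let b = allowed (Vec.map (lookup c₁) as) ∧ (distinct as ≤ᵇ suc r) in
          (bit X R as xor (bit X₀ R as xor bit X₁ R as)) ∧ b ≡ bit X₁ R as ∧ b
        shifted zero agree R as _ = T-ext
          (λ t → contradiction (proj₂ (Equivalence.to (T-∧ {bit X R as xor (bit X₀ R as xor bit X₁ R as)}) t)) forbidden)
          (λ t → contradiction (proj₂ (Equivalence.to (T-∧ {bit X₁ R as}) t)) forbidden)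
          where
          forbidden : ¬ T (allowed (Vec.map (lookup c₁) as) ∧ (distinct as ≤ᵇ 1))
          forbidden t with ok , d ← Equivalence.to T-∧ t =
            few-distinct-forbidden c₁ R as (≤ᵇ⇒≤ (distinct as) 1 d) ok
        shifted (suc r) agree R as eq
          with refl ← expand-↾-suc-colours ω₀ ω₁ r agree =
          ∧-shift (bit X R as) (bit X₀ R as) (bit X₁ R as) _ eq

    fibreSize-suc : ∀ r ω₀ ω₁ → restricted r ω₀ ≡ restricted r ω₁ →
      fibreSize (suc r) (restricted (suc r) ω₀) ≡ fibreSize (suc r) (restricted (suc r) ω₁)
    fibreSize-suc r ω₀ ω₁ agree =
      ≤-antisym (fibreSize-suc-≤ r ω₀ ω₁ agree) (fibreSize-suc-≤ r ω₁ ω₀ (sym agree))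

    restricted-∈ : ∀ r ω → restricted r ω ∈ X ↾ᴸ r
    restricted-∈ r ω = ∈-deduplicate⁺ _≟ˢ_ (∈-map⁺ (_↾ r) (expand-∈ ω))

    ∈-restricted : ∀ r {B} → B ∈ X ↾ᴸ r → ∃ λ ω → restricted r ω ≡ B
    ∈-restricted r B∈
      with M , M∈X , refl ← ∈-map⁻ (_↾ r) (∈-deduplicate⁻ _≟ˢ_ (map (_↾ r) X) B∈)
      with ω , refl ← ∈-expand M∈X = ω , refl

    -- Induction on r. The samples over a restriction to dimension r split into `length Z` fibres
    -- over dimension r+1, all of one size by `fibreSize-suc`; this is exactly the division made by
    -- `ℙ`.
    ℙ-restricted : ∀ r ω → ℙ X r (restricted r ω) ≡ ratio (fibreSize r (restricted r ω)) (length Ω)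
    ℙ-restricted zero ω = 1/≡ratio (fibreSize 0 B) (length Z) (0<length (∈-samples ω)) (begin
      length Z * fibreSize 0 B   ≡⟨ sym (sum-map-const (fibreSize 0) Z λ z∈Z → cong (fibreSize 0) (all-B z∈Z)) ⟩
      sum (map (fibreSize 0) Z)  ≡⟨ sum-of-fibres _≟ˢ_ (restricted 0) Ω {P = λ _ → ⊤}
                                      (deduplicate-! _≟ˢ_ _) (λ _ → yes tt) (λ {ω} _ → restricted-∈ 0 ω) _ ⟩
      count (λ _ → yes tt) Ω     ≡⟨ cong length (filter-all (λ _ → yes tt) (All.universal (λ _ → tt) Ω)) ⟩
      length Ω                   ∎)
      where
      open ≡-Reasoning
      B = restricted 0 ω
      Z = X ↾ᴸ 0
      all-B : ∀ {z} → z ∈ Z → z ≡ B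
      all-B z∈Z with ω′ , refl ← ∈-restricted 0 z∈Z = restricted-0 ω′ ω
    ℙ-restricted (suc r) ω = begin
      ℙ X r (B ↾ r) ℚ.* 1/ length Z
        ≡⟨ cong (λ C → ℙ X r C ℚ.* 1/ length Z) (↾-suc-↾ (expand ω) r) ⟩
      ℙ X r (restricted r ω) ℚ.* 1/ length Z
        ≡⟨ cong (ℚ._* 1/ length Z) (ℙ-restricted r ω) ⟩
      ratio (fibreSize r (restricted r ω)) (length Ω) ℚ.* 1/ length Z
        ≡⟨ ratio-*-1/ (fibreSize (suc r) B) (length Z) (length Ω) (0<length (in-Z {ω} refl)) fibres ⟩
      ratio (fibreSize (suc r) B) (length Ω) ∎
      where
      open ≡-Reasoning
      B = restricted (suc r) ω
      over-B? = λ B′ → (B′ ↾ r) ≟ˢ (B ↾ r)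
      Z = filter over-B? (X ↾ᴸ suc r)

      in-Z : ∀ {ω′} → restricted r ω′ ≡ restricted r ω → restricted (suc r) ω′ ∈ Z
      in-Z {ω′} eq = ∈-filter⁺ over-B? (restricted-∈ (suc r) ω′)
        (trans (↾-suc-↾ (expand ω′) r) (trans eq (sym (↾-suc-↾ (expand ω) r))))

      agree : ∀ {ω′} → restricted (suc r) ω′ ∈ Z → restricted r ω′ ≡ restricted r ω
      agree {ω′} ∈Z = trans (sym (↾-suc-↾ (expand ω′) r))
        (trans (proj₂ (∈-filter⁻ over-B? {xs = X ↾ᴸ suc r} ∈Z)) (↾-suc-↾ (expand ω) r))

      equal-fibres : ∀ {z} → z ∈ Z → fibreSize (suc r) z ≡ fibreSize (suc r) B
      equal-fibres z∈Z
        with ω′ , refl ← ∈-restricted (suc r) (proj₁ (∈-filter⁻ over-B? {xs = X ↾ᴸ suc r} z∈Z)) =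
        fibreSize-suc r ω′ ω (agree {ω′} z∈Z)

      fibres : length Z * fibreSize (suc r) B ≡ fibreSize r (restricted r ω)
      fibres = trans (sym (sum-map-const (fibreSize (suc r)) Z equal-fibres))
        (sum-of-fibres _≟ˢ_ (restricted (suc r)) Ω (filter⁺ over-B? (deduplicate-! _≟ˢ_ (map (_↾ suc r) X)))
          (λ ω′ → restricted r ω′ ≟ˢ restricted r ω)
          (λ {ω′} → in-Z {ω′}) (λ {ω′} → agree {ω′}))

    ℙ-ρ : ∀ {M} → M ∈ X → ℙ X (ρ (Coloured l σ)) M ≡ ratio (fibre _≟ˢ_ expand Ω M) (length Ω)
    ℙ-ρ M∈X with ω , refl ← ∈-expand M∈X = begin
      ℙ X ρ′ (expand ω)
        ≡⟨ cong (ℙ X ρ′) (sym (↾-ρ (expand ω))) ⟩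
      ℙ X ρ′ (restricted ρ′ ω)
        ≡⟨ ℙ-restricted ρ′ ω ⟩
      ratio (fibreSize ρ′ (restricted ρ′ ω)) (length Ω)
        ≡⟨ cong (λ a → ratio a (length Ω))
             (count-cong (λ ω′ → restricted ρ′ ω′ ≟ˢ restricted ρ′ ω) (λ ω′ → expand ω′ ≟ˢ expand ω)
               (λ {ω′} eq → trans (sym (↾-ρ (expand ω′))) (trans eq (↾-ρ (expand ω))))
               (cong (_↾ ρ′)) Ω) ⟩
      ratio (fibre _≟ˢ_ expand Ω (expand ω)) (length Ω) ∎
      where
      open ≡-Reasoning
      ρ′ = ρ (Coloured l σ)

    δ-as-ratio : {Y : Pred (Structure (Coloured l σ) n) 0ℓ} (Y? : Decidable Y) →
      δ X Y? ≡ ratio (count (λ ω → Y? (expand ω)) Ω) (length Ω)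
    δ-as-ratio Y? = trans
      (foldr-ratio (length Ω) (ℙ X (ρ (Coloured l σ))) (fibre _≟ˢ_ expand Ω) (filter Y? X)
        (λ M∈ → ℙ-ρ (proj₁ (∈-filter⁻ Y? M∈))))
      (cong (λ a → ratio a (length Ω))
        (sum-of-fibres _≟ˢ_ expand Ω (filter⁺ Y? X!) (λ ω → Y? (expand ω))
          (λ {ω} Yω → ∈-filter⁺ Y? (expand-∈ ω) Yω)
          (λ ∈Y → proj₂ (∈-filter⁻ Y? {xs = X} ∈Y))))

-- The extension property and generic truth

InjectiveVec : Vec (Fin n) k → Set
InjectiveVec e = ∀ i j → lookup e i ≡ lookup e j → i ≡ j

_∉ᵛ_ : Fin n → Vec (Fin n) k → Set
b ∉ᵛ e = ∀ i → lookup e i ≢ b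

∷-injectiveVec : {b : Fin n} {e : Vec (Fin n) k} → b ∉ᵛ e → InjectiveVec e → InjectiveVec (b ∷ e)
∷-injectiveVec b∉e inj zero    zero    _  = refl
∷-injectiveVec b∉e inj zero    (suc j) eq = contradiction (sym eq) (b∉e j)
∷-injectiveVec b∉e inj (suc i) zero    eq = contradiction eq (b∉e i)
∷-injectiveVec b∉e inj (suc i) (suc j) eq = cong suc (inj i j eq)

_≟ω_ : DecidableEquality (Sample l σ n)
_≟ω_ = Product.≡-dec (Vec.≡-dec Fin._≟_) _≟ˢ_

-- The quantifier-free type of e in the sample, including the bits that `admit` will delete. In
-- `pull (b ∷ e)` the added point has index `zero`, which is the index that `restrict` drops.
pull : Vec (Fin n) k → Sample l σ n → Sample l σ k
pull e (c , X) = Vec.map (lookup c) e , build λ R as → bit X R (Vec.map (lookup e) as)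

restrict : Sample l σ (suc k) → Sample l σ k
restrict (c , X) = Vec.tail c , build λ R as → bit X R (Vec.map suc as)

restrict-pull : (b : Fin n) (e : Vec (Fin n) k) (ω : Sample l σ n) →
  restrict (pull (b ∷ e) ω) ≡ pull e ω
restrict-pull b e ω@(_ , X) = cong (_ ,_) (structure-ext λ R as → begin
  bit (proj₂ (restrict (pull (b ∷ e) ω))) R as  ≡⟨ bit-build _ R as ⟩
  bit (proj₂ (pull (b ∷ e) ω)) R (Vec.map suc as) ≡⟨ bit-build _ R (Vec.map suc as) ⟩
  bit X R (Vec.map (lookup (b ∷ e)) (Vec.map suc as))
    ≡⟨ cong (bit X R) (sym (Vec.map-∘ (lookup (b ∷ e)) suc as)) ⟩
  bit X R (Vec.map (lookup e) as)               ≡⟨ sym (bit-build _ R as) ⟩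
  bit (proj₂ (pull e ω)) R as                   ∎)
  where open ≡-Reasoning

-- Injectivity of e is essential: with a repeated entry, ω′ could treat the two copies differently
-- at the new point, and no b would realise it.
Extends : Sample l σ n → ℕ → Set
Extends {l} {σ} {n} ω j = (e : Vec (Fin n) j) → InjectiveVec e →
  (ω′ : Sample l σ (suc j)) → restrict ω′ ≡ pull e ω →
  ∃ λ b → b ∉ᵛ e × pull (b ∷ e) ω ≡ ω′

-- The extension properties that make φ, with parameters among j points, behave generically.
Suffices : Formula σ k → ℕ → Sample l σ n → Set
Suffices (x ≐ y)    j ω = ⊤
Suffices (rel R xs) j ω = ⊤
Suffices (¬′ φ)     j ω = Suffices φ j ω
Suffices (φ ∧′ ψ)   j ω = Suffices φ j ω × Suffices ψ j ω
Suffices (φ ∨′ ψ)   j ω = Suffices φ j ω × Suffices ψ j ω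
Suffices (φ ⇒′ ψ)   j ω = Suffices φ j ω × Suffices ψ j ω
Suffices (∀′ φ)     j ω = Extends ω j × Suffices φ j ω × Suffices φ (suc j) ω
Suffices (∃′ φ)     j ω = Extends ω j × Suffices φ j ω × Suffices φ (suc j) ω

∀-sample? : {P : Pred (Sample l σ n) 0ℓ} → Decidable P → Dec (∀ ω → P ω)
∀-sample? P? = map′ (λ all ω → All.lookup all (∈-samples ω)) (λ p → All.universal p _)
  (All.all? P? (samples _ _ _))

∃-sample? : {P : Pred (Sample l σ n) 0ℓ} → Decidable P → Dec (∃ P)
∃-sample? P? = map′ Any.satisfied (λ { (ω , p) → lose (∈-samples ω) p })
  (Any.any? P? (samples _ _ _))

module Generic {l : ℕ} {σ : Vocabulary} (allowed : ∀ {m} → Vec (Fin l) m → Bool) where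

  open Admissible {l} {σ} allowed

  -- Truth of φ at the points v of a sample ω that sits inside a larger sample with all
  -- extension properties: quantifiers range over ω and over its one-point extensions.
  GenericTruth : Formula σ k → Sample l σ n → Vec (Fin n) k → Set
  GenericTruth (x ≐ y)    ω v = lookup v x ≡ lookup v y
  GenericTruth (rel R xs) ω v = Holds (admit ω) R (Vec.map (lookup v) xs)
  GenericTruth (¬′ φ)     ω v = ¬ GenericTruth φ ω v
  GenericTruth (φ ∧′ ψ)   ω v = GenericTruth φ ω v × GenericTruth ψ ω v
  GenericTruth (φ ∨′ ψ)   ω v = GenericTruth φ ω v ⊎ GenericTruth ψ ω v
  GenericTruth (φ ⇒′ ψ)   ω v = GenericTruth φ ω v → GenericTruth ψ ω v
  GenericTruth (∀′ φ)     ω v = (∀ a → GenericTruth φ ω (a ∷ v)) ×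
    (∀ ω′ → restrict ω′ ≡ ω → GenericTruth φ ω′ (zero ∷ Vec.map suc v))
  GenericTruth (∃′ φ)     ω v = (∃ λ a → GenericTruth φ ω (a ∷ v)) ⊎
    (∃ λ ω′ → restrict ω′ ≡ ω × GenericTruth φ ω′ (zero ∷ Vec.map suc v))

  genericTruth? : (φ : Formula σ k) (ω : Sample l σ n) (v : Vec (Fin n) k) → Dec (GenericTruth φ ω v)
  genericTruth? (x ≐ y)    ω v = lookup v x Fin.≟ lookup v y
  genericTruth? (rel R xs) ω v = T? _
  genericTruth? (¬′ φ)     ω v = ¬? (genericTruth? φ ω v)
  genericTruth? (φ ∧′ ψ)   ω v = genericTruth? φ ω v ×-dec genericTruth? ψ ω v
  genericTruth? (φ ∨′ ψ)   ω v = genericTruth? φ ω v ⊎-dec genericTruth? ψ ω v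
  genericTruth? (φ ⇒′ ψ)   ω v = genericTruth? φ ω v →-dec genericTruth? ψ ω v
  genericTruth? (∀′ φ)     ω v = Fin.all? (λ a → genericTruth? φ ω (a ∷ v)) ×-dec
    ∀-sample? λ ω′ → (restrict ω′ ≟ω ω) →-dec genericTruth? φ ω′ (zero ∷ Vec.map suc v)
  genericTruth? (∃′ φ)     ω v = Fin.any? (λ a → genericTruth? φ ω (a ∷ v)) ⊎-dec
    ∃-sample? λ ω′ → (restrict ω′ ≟ω ω) ×-dec genericTruth? φ ω′ (zero ∷ Vec.map suc v)

  bit-admit-pull : (e : Vec (Fin n) k) (ω : Sample l σ n) (R : m ∈ σ) (as : Vec (Fin k) m) →
    bit (admit (pull e ω)) R as ≡ bit (admit ω) R (Vec.map (lookup e) as)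
  bit-admit-pull e ω@(c , X) R as = begin
    bit (admit (pull e ω)) R as
      ≡⟨ bit-build _ R as ⟩
    bit (proj₂ (pull e ω)) R as ∧ allowed (Vec.map (lookup (Vec.map (lookup c) e)) as)
      ≡⟨ cong₂ _∧_ (bit-build _ R as) (cong allowed
           (trans (Vec.map-cong (λ i → Vec.lookup-map i (lookup c) e) as) (Vec.map-∘ (lookup c) (lookup e) as))) ⟩
    bit X R (Vec.map (lookup e) as) ∧ allowed (Vec.map (lookup c) (Vec.map (lookup e) as))
      ≡⟨ sym (bit-build _ R (Vec.map (lookup e) as)) ⟩
    bit (admit ω) R (Vec.map (lookup e) as) ∎
    where open ≡-Reasoning

  lookup-map-map : (e : Vec (Fin n) j) (v : Vec (Fin j) k) (xs : Vec (Fin k) m) →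
    Vec.map (lookup e) (Vec.map (lookup v) xs) ≡ Vec.map (lookup (Vec.map (lookup e) v)) xs
  lookup-map-map e v xs = trans (sym (Vec.map-∘ (lookup e) (lookup v) xs))
    (Vec.map-cong (λ x → sym (Vec.lookup-map x (lookup e) v)) xs)

  shift-env : (φ : Formula σ (suc k)) (M : Structure σ n) (b : Fin n) (e : Vec (Fin n) j) (v : Vec (Fin j) k) →
    (M ⊨ φ [ Vec.map (lookup (b ∷ e)) (zero ∷ Vec.map suc v) ]) ≡ (M ⊨ φ [ b ∷ Vec.map (lookup e) v ])
  shift-env φ M b e v = cong (λ u → M ⊨ φ [ b ∷ u ]) (sym (Vec.map-∘ (lookup (b ∷ e)) suc v))

  module _ (ω : Sample l σ n) where

    -- Induction on φ, in both directions at once because negation and implication exchange them.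
    -- The environment v consists of positions in e, so that `pull e ω` holds all that an atom can
    -- ask about it.
    soundness    : (φ : Formula σ k) → Suffices φ j ω → (e : Vec (Fin n) j) → InjectiveVec e →
      (v : Vec (Fin j) k) → GenericTruth φ (pull e ω) v → admit ω ⊨ φ [ Vec.map (lookup e) v ]
    completeness : (φ : Formula σ k) → Suffices φ j ω → (e : Vec (Fin n) j) → InjectiveVec e →
      (v : Vec (Fin j) k) → admit ω ⊨ φ [ Vec.map (lookup e) v ] → GenericTruth φ (pull e ω) v

    soundness (x ≐ y) _ e inj v eq =
      trans (Vec.lookup-map x (lookup e) v) (trans (cong (lookup e) eq) (sym (Vec.lookup-map y (lookup e) v)))
    soundness (rel R xs) _ e inj v h = subst T
      (trans (bit-admit-pull e ω R (Vec.map (lookup v) xs)) (cong (bit (admit ω) R) (lookup-map-map e v xs))) h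
    soundness (¬′ φ)   s       e inj v h = h ∘ completeness φ s e inj v
    soundness (φ ∧′ ψ) (s , t) e inj v   = Product.map (soundness φ s e inj v) (soundness ψ t e inj v)
    soundness (φ ∨′ ψ) (s , t) e inj v   = Sum.map (soundness φ s e inj v) (soundness ψ t e inj v)
    soundness (φ ⇒′ ψ) (s , t) e inj v h = soundness ψ t e inj v ∘ h ∘ completeness φ s e inj v
    soundness (∀′ φ)   (ext , s , t) e inj v (old , new) b
      -- If b is an entry of e, the number of parameters stays j; otherwise it grows to j+1, and the
      -- pattern of `b ∷ e` is itself one of the abstract extensions.
      with Fin.any? (λ i → lookup e i Fin.≟ b)
    ... | yes (i , refl) = soundness φ s e inj (i ∷ v) (old i)
    ... | no  b∉e        = subst id (shift-env φ (admit ω) b e v)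
      (soundness φ t (b ∷ e) (∷-injectiveVec (λ i eq → b∉e (i , eq)) inj) (zero ∷ Vec.map suc v)
        (new (pull (b ∷ e) ω) (restrict-pull b e ω)))
    soundness (∃′ φ)   (ext , s , t) e inj v (inj₁ (i , h)) = lookup e i , soundness φ s e inj (i ∷ v) h
    soundness (∃′ φ)   (ext , s , t) e inj v (inj₂ (ω′ , extends , h))
      -- The extension property turns the abstract extension into an actual point.
      with b , b∉e , refl ← ext e inj ω′ extends =
      b , subst id (shift-env φ (admit ω) b e v)
        (soundness φ t (b ∷ e) (∷-injectiveVec b∉e inj) (zero ∷ Vec.map suc v) h)

    -- Generic truth compares positions, the structure compares points; injectivity of e makes the
    -- two agree.
    completeness (x ≐ y) _ e inj v eq = inj (lookup v x) (lookup v y)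
      (trans (sym (Vec.lookup-map x (lookup e) v)) (trans eq (Vec.lookup-map y (lookup e) v)))
    completeness (rel R xs) _ e inj v h = subst T (sym
      (trans (bit-admit-pull e ω R (Vec.map (lookup v) xs)) (cong (bit (admit ω) R) (lookup-map-map e v xs)))) h
    completeness (¬′ φ)   s       e inj v h = h ∘ soundness φ s e inj v
    completeness (φ ∧′ ψ) (s , t) e inj v   = Product.map (completeness φ s e inj v) (completeness ψ t e inj v)
    completeness (φ ∨′ ψ) (s , t) e inj v   = Sum.map (completeness φ s e inj v) (completeness ψ t e inj v)
    completeness (φ ⇒′ ψ) (s , t) e inj v h = completeness ψ t e inj v ∘ h ∘ soundness φ s e inj v
    completeness (∀′ φ)   (ext , s , t) e inj v h =
      (λ i → completeness φ s e inj (i ∷ v) (h (lookup e i))) , new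
      where
      new : ∀ ω′ → restrict ω′ ≡ pull e ω → GenericTruth φ ω′ (zero ∷ Vec.map suc v)
      new ω′ extends with b , b∉e , refl ← ext e inj ω′ extends =
        completeness φ t (b ∷ e) (∷-injectiveVec b∉e inj) (zero ∷ Vec.map suc v)
          (subst id (sym (shift-env φ (admit ω) b e v)) (h b))
    completeness (∃′ φ)   (ext , s , t) e inj v (b , h) with Fin.any? (λ i → lookup e i Fin.≟ b)
    ... | yes (i , refl) = inj₁ (i , completeness φ s e inj (i ∷ v) h)
    ... | no  b∉e        = inj₂ (pull (b ∷ e) ω , restrict-pull b e ω ,
      completeness φ t (b ∷ e) (∷-injectiveVec (λ i eq → b∉e (i , eq)) inj) (zero ∷ Vec.map suc v)
        (subst id (sym (shift-env φ (admit ω) b e v)) h))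

-- Overwriting a sample at finitely many points

map-lookup-injective : {f : Vec (Fin n) k} → InjectiveVec f → (is js : Vec (Fin k) m) →
  Vec.map (lookup f) is ≡ Vec.map (lookup f) js → is ≡ js
map-lookup-injective         inj []       []       _  = refl
map-lookup-injective {f = f} inj (i ∷ is) (j ∷ js) eq =
  cong₂ _∷_ (inj i j (Vec.∷-injectiveˡ eq)) (map-lookup-injective {f = f} inj is js (Vec.∷-injectiveʳ eq))

preimage? : (f : Vec (Fin n) k) (as : Vec (Fin n) m) → Dec (∃ λ is → Vec.map (lookup f) is ≡ as)
preimage? f []       = yes ([] , refl)
preimage? f (a ∷ as) = map′
  (λ { ((i , refl) , (is , refl)) → i ∷ is , refl })
  (λ { (i ∷ is , refl) → (i , refl) , (is , refl) })
  (Fin.any? (λ i → lookup f i Fin.≟ a) ×-dec preimage? f as)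

overlay : Vec (Fin n) k → (Vec (Fin k) m → A) → (Vec (Fin n) m → A) → Vec (Fin n) m → A
overlay f q p as with preimage? f as
... | yes (is , _) = q is
... | no  _        = p as

overlay-≡ : (f : Vec (Fin n) k) (q : Vec (Fin k) m → A) (p : Vec (Fin n) m → A) {as : Vec (Fin n) m} {x : A} →
  (∀ is → Vec.map (lookup f) is ≡ as → q is ≡ x) →
  (¬ (∃ λ is → Vec.map (lookup f) is ≡ as) → p as ≡ x) →
  overlay f q p as ≡ x
overlay-≡ f q p {as} inside outside with preimage? f as
... | yes (is , eq) = inside is eq
... | no  none      = outside none

overlay-inside : {f : Vec (Fin n) k} → InjectiveVec f → (q : Vec (Fin k) m → A) (p : Vec (Fin n) m → A)
  (is : Vec (Fin k) m) → overlay f q p (Vec.map (lookup f) is) ≡ q is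
overlay-inside {f = f} inj q p is = overlay-≡ f q p
  (λ js eq → cong q (map-lookup-injective {f = f} inj js is eq)) (λ none → contradiction (is , refl) none)

overlay-undo : (f : Vec (Fin n) k) (q : Vec (Fin k) m → A) (p : Vec (Fin n) m → A) (as : Vec (Fin n) m) →
  overlay f (p ∘ Vec.map (lookup f)) (overlay f q p) as ≡ p as
overlay-undo f q p as = overlay-≡ f _ _ (λ is eq → cong p eq)
  λ none → overlay-≡ f q p (λ is eq → contradiction (is , eq) none) (λ _ → refl)

-- A tuple within `b ∷ e` that avoids b lies within e, where q was assumed to agree with p.
overlay-avoiding : (b : Fin n) (e : Vec (Fin n) k) (q : Vec (Fin (suc k)) m → A) (p : Vec (Fin n) m → A) →
  (∀ is → q (Vec.map suc is) ≡ p (Vec.map (lookup e) is)) →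
  (as : Vec (Fin n) m) → b ∉ᵛ as → overlay (b ∷ e) q p as ≡ p as
overlay-avoiding {n} b e q p agree as b∉as = overlay-≡ (b ∷ e) q p inside (λ _ → refl)
  where
  predecessors : ∀ {m} (js : Vec (Fin (suc _)) m) {as : Vec (Fin n) m} → Vec.map (lookup (b ∷ e)) js ≡ as →
    b ∉ᵛ as → ∃ λ is → js ≡ Vec.map suc is
  predecessors []           _    _    = [] , refl
  predecessors (zero ∷ js)  refl b∉as = contradiction refl (b∉as zero)
  predecessors (suc i ∷ js) refl b∉as with is , refl ← predecessors js refl (b∉as ∘ suc) = i ∷ is , refl

  inside : ∀ js → Vec.map (lookup (b ∷ e)) js ≡ as → q js ≡ p as
  inside js eq with is , refl ← predecessors js eq b∉as =
    trans (agree is) (cong p (trans (Vec.map-∘ (lookup (b ∷ e)) suc is) eq))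

-- Reading a colouring as a function of 1-tuples lets `overlay` and its lemmas handle colours and
-- relations alike.
colourAt : Vec (Fin l) n → Vec (Fin n) 1 → Fin l
colourAt c as = lookup c (head as)

overwrite : Vec (Fin n) k → Sample l σ k → Sample l σ n → Sample l σ n
overwrite f (d , Y) (c , X) =
  Vec.tabulate (λ a → overlay f (colourAt d) (colourAt c) (a ∷ [])) ,
  build λ R → overlay f (bit Y R) (bit X R)

sample-ext : {ω ω′ : Sample l σ n} → (∀ a → lookup (proj₁ ω) a ≡ lookup (proj₁ ω′) a) →
  (∀ {m} (R : m ∈ σ) as → bit (proj₂ ω) R as ≡ bit (proj₂ ω′) R as) → ω ≡ ω′
sample-ext colours bits = cong₂ _,_ (vec-ext colours) (structure-ext bits)

pull-overwrite : {f : Vec (Fin n) k} → InjectiveVec f → (ω′ : Sample l σ k) (ω : Sample l σ n) →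
  pull f (overwrite f ω′ ω) ≡ ω′
pull-overwrite {f = f} inj ω′@(d , Y) ω@(c , X) = sample-ext
  (λ i → trans (Vec.lookup-map i _ f) (trans (Vec.lookup∘tabulate _ (lookup f i))
    (overlay-inside {f = f} inj (colourAt d) (colourAt c) (i ∷ []))))
  λ R is → trans (bit-build _ R is) (trans (bit-build _ R (Vec.map (lookup f) is))
    (overlay-inside {f = f} inj (bit Y R) (bit X R) is))

overlay-cong : (f : Vec (Fin n) k) {q q′ : Vec (Fin k) m → A} {p p′ : Vec (Fin n) m → A} →
  (∀ is → q is ≡ q′ is) → (∀ as → p as ≡ p′ as) → ∀ as → overlay f q p as ≡ overlay f q′ p′ as
overlay-cong f q≡ p≡ as with preimage? f as
... | yes (is , _) = q≡ is
... | no  _        = p≡ as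

-- Overwriting destroys no more than `pull f ω`. Paired with that record it becomes injective, which
-- is how the constant `C` enters the estimates.
overwrite-undo : (f : Vec (Fin n) k) (ω′ : Sample l σ k) (ω : Sample l σ n) →
  overwrite f (pull f ω) (overwrite f ω′ ω) ≡ ω
overwrite-undo f ω′@(d , Y) ω@(c , X) = sample-ext
  (λ a → trans (Vec.lookup∘tabulate _ a)
    (trans (overlay-cong f (λ { (i ∷ []) → Vec.lookup-map i (lookup c) f })
                           (λ { (a ∷ []) → Vec.lookup∘tabulate _ a }) (a ∷ []))
      (overlay-undo f (colourAt d) (colourAt c) (a ∷ []))))
  λ R as → trans (bit-build _ R as)
    (trans (overlay-cong f (bit-build _ R) (bit-build _ R) as) (overlay-undo f (bit Y R) (bit X R) as))

lookup-∉ᵛ : {b : Fin n} {f : Vec (Fin n) k} → b ∉ᵛ f → (is : Vec (Fin k) m) → b ∉ᵛ Vec.map (lookup f) is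
lookup-∉ᵛ {f = f} b∉f is i eq = b∉f (lookup is i) (trans (sym (Vec.lookup-map i (lookup f) is)) eq)

-- This replaces independence: as ω′ agrees with ω on e, overwriting changes only the colour of b
-- and tuples through b, and a candidate b′ different from b does not notice.
pull-overwrite-avoiding : (b : Fin n) (e : Vec (Fin n) k) (ω′ : Sample l σ (suc k)) (ω : Sample l σ n) →
  restrict ω′ ≡ pull e ω → (g : Vec (Fin n) m) → b ∉ᵛ g →
  pull g (overwrite (b ∷ e) ω′ ω) ≡ pull g ω
pull-overwrite-avoiding b e ω′@(d₀ ∷ d , Y) ω@(c , X) extends g b∉g = sample-ext
  (λ i → trans (Vec.lookup-map i _ g) (trans (Vec.lookup∘tabulate _ (lookup g i))
    (trans (overlay-avoiding b e (colourAt (d₀ ∷ d)) (colourAt c) colours (lookup g i ∷ []) λ { zero → b∉g i })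
      (sym (Vec.lookup-map i (lookup c) g)))))
  λ R is → trans (bit-build _ R is) (trans (bit-build _ R (Vec.map (lookup g) is))
    (trans (overlay-avoiding b e (bit Y R) (bit X R) (bits R) (Vec.map (lookup g) is) (lookup-∉ᵛ {f = g} b∉g is))
      (sym (bit-build _ R is))))
  where
  colours : ∀ is → colourAt (d₀ ∷ d) (Vec.map suc is) ≡ colourAt c (Vec.map (lookup e) is)
  colours (i ∷ []) = trans (cong (λ ω → lookup (proj₁ ω) i) extends) (Vec.lookup-map i (lookup c) e)
  bits : ∀ {m} (R : m ∈ _) is → bit Y R (Vec.map suc is) ≡ bit X R (Vec.map (lookup e) is)
  bits R is = trans (sym (bit-build _ R is))
    (trans (cong (λ ω → bit (proj₂ ω) R is) extends) (bit-build _ R is))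

-- Samples without a given extension

module Failures {l : ℕ} {σ : Vocabulary} {n k : ℕ} (e : Vec (Fin n) k) (inj : InjectiveVec e)
  (ω′ : Sample l σ (suc k)) where

  compatible? : Decidable λ (ω : Sample l σ n) → restrict ω′ ≡ pull e ω
  compatible? ω = restrict ω′ ≟ω pull e ω

  realises? : ∀ b → Decidable λ (ω : Sample l σ n) → pull (b ∷ e) ω ≡ ω′
  realises? b ω = pull (b ∷ e) ω ≟ω ω′

  -- The candidates are excluded one at a time, so that each contributes a factor to the bound.
  -- Samples incompatible with ω′ are left out from the start, since the extension property demands
  -- nothing of them.
  failures : List (Fin n) → List (Sample l σ n)
  failures []      = filter compatible? (samples l σ n)
  failures (b ∷ S) = filter (¬? ∘ realises? b) (failures S)

  failures-! : ∀ S → Unique (failures S)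
  failures-! []      = filter⁺ compatible? (samples-! l σ n)
  failures-! (b ∷ S) = filter⁺ (¬? ∘ realises? b) (failures-! S)

  ∈-failures : ∀ S {ω} → restrict ω′ ≡ pull e ω → (∀ {b} → b ∈ S → pull (b ∷ e) ω ≢ ω′) → ω ∈ failures S
  ∈-failures []      {ω} extends _     = ∈-filter⁺ compatible? (∈-samples ω) extends
  ∈-failures (b ∷ S) {ω} extends fails =
    ∈-filter⁺ (¬? ∘ realises? b) (∈-failures S extends (fails ∘ there)) (fails (here refl))

  failures-compatible : ∀ S {ω} → ω ∈ failures S → restrict ω′ ≡ pull e ω
  failures-compatible []      ω∈ = proj₂ (∈-filter⁻ compatible? {xs = samples l σ n} ω∈)
  failures-compatible (b ∷ S) ω∈ = failures-compatible S (proj₁ (∈-filter⁻ (¬? ∘ realises? b) ω∈))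

  failures-fail : ∀ S {ω} → ω ∈ failures S → ∀ {b} → b ∈ S → pull (b ∷ e) ω ≢ ω′
  failures-fail (b ∷ S) ω∈ (here refl) = proj₂ (∈-filter⁻ (¬? ∘ realises? b) {xs = failures S} ω∈)
  failures-fail (b ∷ S) ω∈ (there b∈S) = failures-fail S (proj₁ (∈-filter⁻ (¬? ∘ realises? b) ω∈)) b∈S

  C : ℕ
  C = length (samples l σ (suc k))

  -- Overwriting a failing sample at b ∷ e by ω′ affects no other candidate b′, and the
  -- overwritten part is one of C samples.
  failures-≤-realisations : ∀ b S → b ∉ S → b ∉ᵛ e →
    length (failures S) ≤ length (filter (realises? b) (failures S)) * C
  failures-≤-realisations b S b∉S b∉e = subst (length (failures S) ≤_)
    (length-cartesianProductWith _,_ (filter (realises? b) (failures S)) (samples l σ (suc k)))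
    (length-≤-by-injection (λ ω → overwrite (b ∷ e) ω′ ω , pull (b ∷ e) ω) (failures-! S)
      (λ {ω} ω∈ → ∈-cartesianProduct⁺ (∈-filter⁺ (realises? b) (still-fails ω ω∈) (realised ω))
                    (∈-samples (pull (b ∷ e) ω)))
      (λ {ω} {ω₁} _ _ eq → trans (sym (overwrite-undo (b ∷ e) ω′ ω))
        (trans (cong₂ (overwrite (b ∷ e)) (cong proj₂ eq) (cong proj₁ eq)) (overwrite-undo (b ∷ e) ω′ ω₁))))
    where
    realised : ∀ ω → pull (b ∷ e) (overwrite (b ∷ e) ω′ ω) ≡ ω′
    realised = pull-overwrite (∷-injectiveVec b∉e inj) ω′

    still-fails : ∀ ω → ω ∈ failures S → overwrite (b ∷ e) ω′ ω ∈ failures S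
    still-fails ω ω∈ = ∈-failures S
      (trans (cong restrict (sym (realised ω))) (restrict-pull b e (overwrite (b ∷ e) ω′ ω)))
      λ {b′} b′∈S eq → failures-fail S ω∈ b′∈S (trans
        (sym (pull-overwrite-avoiding b e ω′ ω (failures-compatible S ω∈) (b′ ∷ e)
          λ { zero refl → b∉S b′∈S ; (suc i) → b∉e i })) eq)

  -- The part still failing at b is at most the whole, hence at most `C` times the realising part.
  -- Adding `C` times the failing part completes `C` times the whole; the factor C/(C+1) arises
  -- without any subtraction.
  failures-decrease : ∀ b S → b ∉ S → b ∉ᵛ e → suc C * length (failures (b ∷ S)) ≤ C * length (failures S)
  failures-decrease b S b∉S b∉e = begin
    length (failures (b ∷ S)) + C * length (failures (b ∷ S))
      ≤⟨ +-monoˡ-≤ _ (≤-trans (length-filter (¬? ∘ realises? b) (failures S)) (failures-≤-realisations b S b∉S b∉e)) ⟩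
    length realised * C + C * length (failures (b ∷ S))
      ≡⟨ cong (_+ C * length (failures (b ∷ S))) (*-comm (length realised) C) ⟩
    C * length realised + C * length (failures (b ∷ S))
      ≡⟨ sym (*-distribˡ-+ C (length realised) _) ⟩
    C * (length realised + length (failures (b ∷ S)))
      ≡⟨ cong (C *_) (count-+-count-¬ (realises? b) (failures S)) ⟩
    C * length (failures S) ∎
    where
    open ≤-Reasoning
    realised = filter (realises? b) (failures S)

  failures-bound : ∀ {S} → Unique S → (∀ {b} → b ∈ S → b ∉ᵛ e) →
    suc C ^ length S * length (failures S) ≤ C ^ length S * length (samples l σ n)
  failures-bound {[]}    _           _    = *-monoʳ-≤ 1 (length-filter compatible? (samples l σ n))
  failures-bound {b ∷ S} (b∉S ∷ S!) S∉e = begin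
    suc C * suc C ^ s * length (failures (b ∷ S))    ≡⟨ swap (suc C) (suc C ^ s) _ ⟩
    suc C ^ s * (suc C * length (failures (b ∷ S)))
      ≤⟨ *-monoʳ-≤ (suc C ^ s) (failures-decrease b S (λ b∈S → All.lookup b∉S b∈S refl) (S∉e (here refl))) ⟩
    suc C ^ s * (C * length (failures S))            ≡⟨ sym (swap C (suc C ^ s) _) ⟩
    C * suc C ^ s * length (failures S)              ≡⟨ *-assoc C (suc C ^ s) _ ⟩
    C * (suc C ^ s * length (failures S))            ≤⟨ *-monoʳ-≤ C (failures-bound S! (S∉e ∘ there)) ⟩
    C * (C ^ s * length (samples l σ n))             ≡⟨ sym (*-assoc C (C ^ s) _) ⟩
    C * C ^ s * length (samples l σ n)               ∎
    where
    open ≤-Reasoning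
    s = length S
    swap : ∀ x y z → x * y * z ≡ y * (x * z)
    swap = solve-∀

-- Exponential against polynomial growth

^-distribʳ-* : ∀ m n o → (m * n) ^ o ≡ m ^ o * n ^ o
^-distribʳ-* m n zero    = refl
^-distribʳ-* m n (suc o) = trans (cong (m * n *_) (^-distribʳ-* m n o)) (interchange m n (m ^ o) (n ^ o))
  where
  interchange : ∀ m n x y → m * n * (x * y) ≡ m * x * (n * y)
  interchange = solve-∀

-- Bernoulli's inequality for (1 + 1/C)^m, multiplied by C^(m+1).
bernoulli : ∀ C m → C ^ m * (C + m) ≤ suc C ^ m * C
bernoulli C zero    = ≤-reflexive (cong (1 *_) (+-identityʳ C))
bernoulli C (suc m) = begin
  C * C ^ m * (C + suc m)              ≡⟨ expand C (C ^ m) m ⟩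
  C ^ m * (C * C + C * m + C)          ≤⟨ *-monoʳ-≤ (C ^ m) (m≤m+n _ m) ⟩
  C ^ m * (C * C + C * m + C + m)      ≡⟨ collect C (C ^ m) m ⟩
  suc C * (C ^ m * (C + m))            ≤⟨ *-monoʳ-≤ (suc C) (bernoulli C m) ⟩
  suc C * (suc C ^ m * C)              ≡⟨ sym (*-assoc (suc C) (suc C ^ m) C) ⟩
  suc C * suc C ^ m * C                ∎
  where
  open ≤-Reasoning
  expand : ∀ C x m → C * x * (C + suc m) ≡ x * (C * C + C * m + C)
  expand = solve-∀
  collect : ∀ C x m → x * (C * C + C * m + C + m) ≡ suc C * (x * (C + m))
  collect = solve-∀

-- With s split into p = j + 1 blocks of length q, Bernoulli's inequality in each block gives
-- (1 + 1/C)^s a lower bound of order q^p, which beats n^j.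
exponential-beats-polynomial : ∀ j C K →
  ∃ λ N → ∀ {n s} → n ≥ N → n ≤ s + j → K * (n ^ j * C) * C ^ s ≤ suc C ^ s
exponential-beats-polynomial j zero K = 0 , λ {n} {s} _ _ →
  subst (λ x → K * x * 0 ^ s ≤ 1 ^ s) (sym (*-zeroʳ (n ^ j)))
    (subst (λ x → x * 0 ^ s ≤ 1 ^ s) (sym (*-zeroʳ K)) z≤n)
-- Since n < (q+2) p, the threshold forces q to be at least Q+2. Then q absorbs the constant Q, and
-- q+2 is at most 2q, which gives the bound of n by 2pq.
exponential-beats-polynomial j C@(suc _) K = (Q + 4) * p , bound
  where
  open ≤-Reasoning
  p = suc j
  -- The constants left after n^j is bounded by (2pq)^j. The factor `C ^ p` pays for the C that
  -- `bernoulli` costs in each of the p blocks.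
  Q = K * (2 * p) ^ j * C * C ^ p

  bound : ∀ {n s} → n ≥ (Q + 4) * p → n ≤ s + j → K * (n ^ j * C) * C ^ s ≤ suc C ^ s
  bound {n} {s} n≥N n≤s+j = *-cancelˡ-≤ (C ^ p) {{m^n≢0 C p}} (begin
    C ^ p * (K * (n ^ j * C) * C ^ s)
      ≤⟨ *-monoʳ-≤ (C ^ p) (*-monoˡ-≤ (C ^ s) (*-monoʳ-≤ K (*-monoˡ-≤ C (^-monoˡ-≤ j n≤2pq)))) ⟩
    C ^ p * (K * ((2 * p * q) ^ j * C) * C ^ s)
      ≡⟨ cong (λ x → C ^ p * (K * (x * C) * C ^ s)) (^-distribʳ-* (2 * p) q j) ⟩
    C ^ p * (K * ((2 * p) ^ j * q ^ j * C) * C ^ s)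
      ≡⟨ collect (C ^ p) K ((2 * p) ^ j) (q ^ j) C (C ^ s) ⟩
    Q * (q ^ j * C ^ s)
      ≤⟨ *-monoˡ-≤ (q ^ j * C ^ s) (≤-trans (m≤m+n Q 2) Q+2≤q) ⟩
    q * (q ^ j * C ^ s)
      ≡⟨ cong (λ x → q * (q ^ j * x)) (split C) ⟩
    q * (q ^ j * (C ^ r * (C ^ q) ^ p))
      ≡⟨ regroup q (q ^ j) (C ^ r) ((C ^ q) ^ p) ⟩
    C ^ r * ((C ^ q) ^ p * q ^ p)
      ≡⟨ cong (C ^ r *_) (sym (^-distribʳ-* (C ^ q) q p)) ⟩
    C ^ r * (C ^ q * q) ^ p
      ≤⟨ *-mono-≤ (^-monoˡ-≤ r (n≤1+n C))
           (^-monoˡ-≤ p (≤-trans (*-monoʳ-≤ (C ^ q) (m≤n+m q C)) (bernoulli C q))) ⟩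
    suc C ^ r * (suc C ^ q * C) ^ p
      ≡⟨ cong (suc C ^ r *_) (^-distribʳ-* (suc C ^ q) C p) ⟩
    suc C ^ r * ((suc C ^ q) ^ p * C ^ p)
      ≡⟨ rotate (suc C ^ r) ((suc C ^ q) ^ p) (C ^ p) ⟩
    C ^ p * (suc C ^ r * (suc C ^ q) ^ p)
      ≡⟨ cong (C ^ p *_) (sym (split (suc C))) ⟩
    C ^ p * suc C ^ s ∎)
    where
    q = s / p
    r = s % p

    split : ∀ b → b ^ s ≡ b ^ r * (b ^ q) ^ p
    split b = trans (cong (b ^_) (m≡m%n+[m/n]*n s p))
      (trans (^-distribˡ-+-* b r (q * p)) (cong (b ^ r *_) (sym (^-*-assoc b q p))))

    n<[q+2]p : n < (q + 2) * p
    n<[q+2]p = begin-strict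
      n                  ≤⟨ n≤s+j ⟩
      s + j              ≡⟨ cong (_+ j) (m≡m%n+[m/n]*n s p) ⟩
      r + q * p + j      <⟨ +-mono-<-≤ (+-monoˡ-< (q * p) (m%n<n s p)) (n≤1+n j) ⟩
      p + q * p + p      ≡⟨ gather p q ⟩
      (q + 2) * p        ∎
      where
      gather : ∀ p q → p + q * p + p ≡ (q + 2) * p
      gather = solve-∀

    Q+2≤q : Q + 2 ≤ q
    Q+2≤q = +-cancelʳ-≤ 2 (Q + 2) q (begin
      Q + 2 + 2  ≡⟨ +-assoc Q 2 2 ⟩
      Q + 4      ≤⟨ <⇒≤ (*-cancelʳ-< p (Q + 4) (q + 2) (≤-<-trans n≥N n<[q+2]p)) ⟩
      q + 2      ∎)

    n≤2pq : n ≤ 2 * p * q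
    n≤2pq = begin
      n              ≤⟨ <⇒≤ n<[q+2]p ⟩
      (q + 2) * p    ≤⟨ *-monoˡ-≤ p (+-monoʳ-≤ q (≤-trans (m≤n+m 2 Q) Q+2≤q)) ⟩
      (q + q) * p    ≡⟨ double p q ⟩
      2 * p * q      ∎
      where
      double : ∀ p q → (q + q) * p ≡ 2 * p * q
      double = solve-∀

    collect : ∀ x K y z C w → x * (K * (y * z * C) * w) ≡ K * y * C * x * (z * w)
    collect = solve-∀
    regroup : ∀ q x y z → q * (x * (y * z)) ≡ y * (z * (q * x))
    regroup = solve-∀
    rotate : ∀ x y z → x * (y * z) ≡ z * (x * y)
    rotate = solve-∀

-- Numbers of tuples and of points outside a tuple

length-vectors : (xs : List A) (n : ℕ) → length (vectors xs n) ≡ length xs ^ n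
length-vectors xs zero    = refl
length-vectors xs (suc n) = trans (length-cartesianProductWith _∷_ xs (vectors xs n))
  (cong (length xs *_) (length-vectors xs n))

length-allFin : ∀ n → length (allFin n) ≡ n
length-allFin n = length-tabulate {n = n} id

_∉ᵛ?_ : (b : Fin n) (e : Vec (Fin n) k) → Dec (b ∉ᵛ e)
b ∉ᵛ? e = Fin.all? λ i → ¬? (lookup e i Fin.≟ b)

injectiveVec? : (e : Vec (Fin n) k) → Dec (InjectiveVec e)
injectiveVec? e = Fin.all? λ i → Fin.all? λ j → (lookup e i Fin.≟ lookup e j) →-dec (i Fin.≟ j)

outside : Vec (Fin n) k → List (Fin n)
outside e = filter (_∉ᵛ? e) (allFin _)

length-outside : (e : Vec (Fin n) k) → n ≤ length (outside e) + k
length-outside {n} {k} e = begin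
  n                                                     ≡⟨ sym (length-allFin n) ⟩
  length (allFin n)                                     ≤⟨ length-≤-by-inclusion (allFin⁺ n) (λ {b} _ → covered b) ⟩
  length (outside e ++ map (lookup e) (allFin k))       ≡⟨ length-++ (outside e) ⟩
  length (outside e) + length (map (lookup e) (allFin k))
    ≡⟨ cong (length (outside e) +_) (trans (length-map (lookup e) (allFin k)) (length-allFin k)) ⟩
  length (outside e) + k                                ∎
  where
  open ≤-Reasoning
  covered : ∀ b → b ∈ outside e ++ map (lookup e) (allFin k)
  covered b with Fin.any? (λ i → lookup e i Fin.≟ b)
  ... | yes (i , refl) = ∈-++⁺ʳ (outside e) (∈-map⁺ (lookup e) (∈-allFin i))
  ... | no  b∉e        = ∈-++⁺ˡ (∈-filter⁺ (_∉ᵛ? e) (∈-allFin b) λ i eq → b∉e (i , eq))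

-- Almost sure properties of samples

AlmostSurely : ∀ l σ → (∀ {n} → Sample l σ n → Set) → Set
AlmostSurely l σ P = ∀ K → ∃ λ N → ∀ n → n ≥ N → ∃ λ (bad : List (Sample l σ n)) →
  K * length bad ≤ length (samples l σ n) × (∀ ω → ω ∉ bad → P ω)

almostSurely-⊤ : ∀ l σ → AlmostSurely l σ (λ _ → ⊤)
almostSurely-⊤ l σ K = 0 , λ n _ → [] , subst (_≤ length (samples l σ n)) (sym (*-zeroʳ K)) z≤n , _

almostSurely-× : ∀ {l σ} {P Q : ∀ {n} → Sample l σ n → Set} →
  AlmostSurely l σ P → AlmostSurely l σ Q → AlmostSurely l σ (λ ω → P ω × Q ω)
almostSurely-× {l} {σ} asP asQ K
  -- Each property receives half of the permitted share of exceptions.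
  with N , p ← asP (2 * K) | N′ , q ← asQ (2 * K) = N ⊔ N′ , both
  where
  open ≤-Reasoning
  both : ∀ n → n ≥ N ⊔ N′ → _
  both n n≥
    with bad , few , good ← p n (≤-trans (m≤m⊔n N N′) n≥)
       | bad′ , few′ , good′ ← q n (≤-trans (m≤n⊔m N N′) n≥) =
    bad ++ bad′ ,
    *-cancelˡ-≤ 2 (begin
      2 * (K * length (bad ++ bad′))              ≡⟨ cong (λ x → 2 * (K * x)) (length-++ bad) ⟩
      2 * (K * (length bad + length bad′))        ≡⟨ distribute K (length bad) (length bad′) ⟩
      2 * K * length bad + 2 * K * length bad′    ≤⟨ +-mono-≤ few few′ ⟩
      W + W                                       ≡⟨ cong (W +_) (sym (+-identityʳ W)) ⟩
      2 * W                                       ∎) ,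
    λ ω ω∉ → good ω (ω∉ ∘ ∈-++⁺ˡ) , good′ ω (ω∉ ∘ ∈-++⁺ʳ bad)
    where
    W = length (samples l σ n)
    distribute : ∀ K x y → 2 * (K * (x + y)) ≡ 2 * K * x + 2 * K * y
    distribute = solve-∀

almostSurely-extends : ∀ {l σ} j → AlmostSurely l σ (λ ω → Extends ω j)
almostSurely-extends {l} {σ} j K
  with N , beats ← exponential-beats-polynomial j (length (samples l σ (suc j))) K =
  N , λ n n≥N → concatMap bad (instances n) ,
    -- The instances are n^j tuples e, each with `C` extensions ω′; the same `C` governs the decay
    -- in the number of candidates.
    length-concatMap-≤ K (n ^ j * C) (length (samples l σ n)) bad (instances n)
      (≤-reflexive (length-instances n)) (λ {x} _ → few n≥N x) ,
    good
  where
  C = length (samples l σ (suc j))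

  instances : ∀ n → List (Vec (Fin n) j × Sample l σ (suc j))
  instances n = cartesianProduct (vectors (allFin n) j) (samples l σ (suc j))

  length-instances : ∀ n → length (instances n) ≡ n ^ j * C
  length-instances n = trans (length-cartesianProductWith _,_ (vectors (allFin n) j) (samples l σ (suc j)))
    (cong (_* C) (trans (length-vectors (allFin n) j) (cong (_^ j) (length-allFin n))))

  bad : ∀ {n} → Vec (Fin n) j × Sample l σ (suc j) → List (Sample l σ n)
  bad (e , ω′) with injectiveVec? e
  ... | yes inj = Failures.failures e inj ω′ (outside e)
  ... | no  _   = []

  few : ∀ {n} → n ≥ N → (x : Vec (Fin n) j × Sample l σ (suc j)) →
    K * (n ^ j * C) * length (bad x) ≤ length (samples l σ n)
  few {n} n≥N (e , ω′) with injectiveVec? e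
  ... | no  _   = subst (_≤ length (samples l σ n)) (sym (*-zeroʳ (K * (n ^ j * C)))) z≤n
  ... | yes inj = *-cancelˡ-≤ (suc C ^ s) {{m^n≢0 (suc C) s}} (begin
    suc C ^ s * (K * (n ^ j * C) * f)    ≡⟨ swap (suc C ^ s) (K * (n ^ j * C)) f ⟩
    K * (n ^ j * C) * (suc C ^ s * f)
      ≤⟨ *-monoʳ-≤ (K * (n ^ j * C)) (failures-bound (filter⁺ (_∉ᵛ? e) (allFin⁺ n))
           λ b∈ → proj₂ (∈-filter⁻ (_∉ᵛ? e) {xs = allFin n} b∈)) ⟩
    K * (n ^ j * C) * (C ^ s * W)        ≡⟨ sym (*-assoc (K * (n ^ j * C)) (C ^ s) W) ⟩
    K * (n ^ j * C) * C ^ s * W          ≤⟨ *-monoˡ-≤ W (beats n≥N (length-outside e)) ⟩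
    suc C ^ s * W                        ∎)
    where
    open ≤-Reasoning
    open Failures e inj ω′ using (failures; failures-bound)
    s = length (outside e)
    f = length (failures (outside e))
    W = length (samples l σ n)
    swap : ∀ x y z → x * (y * z) ≡ y * (x * z)
    swap = solve-∀

  good : ∀ {n} (ω : Sample l σ n) → ω ∉ concatMap bad (instances n) → Extends ω j
  good {n} ω ω∉ e inj ω′ extends
    -- The search over all points keeps the argument constructive: when it fails, ω is among the
    -- failures for (e , ω′).
    with Fin.any? (λ b → (b ∉ᵛ? e) ×-dec (pull (b ∷ e) ω ≟ω ω′))
  ... | yes found = found
  ... | no  none  = contradiction (∈-concatMap⁺ bad (lose instance∈ ω∈bad)) ω∉
    where
    instance∈ : (e , ω′) ∈ instances n
    instance∈ = ∈-cartesianProduct⁺ (∈-vectors ∈-allFin e) (∈-samples ω′)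
    ω∈bad : ω ∈ bad (e , ω′)
    ω∈bad with injectiveVec? e
    ... | no ¬inj  = contradiction inj ¬inj
    ... | yes inj′ = Failures.∈-failures e inj′ ω′ (outside e) extends λ {b} b∈ eq →
      none (b , proj₂ (∈-filter⁻ (_∉ᵛ? e) {xs = allFin n} b∈) , eq)

almostSurely-suffices : ∀ {l σ k} (φ : Formula σ k) j → AlmostSurely l σ (Suffices φ j)
almostSurely-suffices (x ≐ y)    j = almostSurely-⊤ _ _
almostSurely-suffices (rel R xs) j = almostSurely-⊤ _ _
almostSurely-suffices (¬′ φ)     j = almostSurely-suffices φ j
almostSurely-suffices (φ ∧′ ψ)   j = almostSurely-× (almostSurely-suffices φ j) (almostSurely-suffices ψ j)
almostSurely-suffices (φ ∨′ ψ)   j = almostSurely-× (almostSurely-suffices φ j) (almostSurely-suffices ψ j)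
almostSurely-suffices (φ ⇒′ ψ)   j = almostSurely-× (almostSurely-suffices φ j) (almostSurely-suffices ψ j)
almostSurely-suffices (∀′ φ)     j = almostSurely-× (almostSurely-extends j)
  (almostSurely-× (almostSurely-suffices φ j) (almostSurely-suffices φ (suc j)))
almostSurely-suffices (∃′ φ)     j = almostSurely-× (almostSurely-extends j)
  (almostSurely-× (almostSurely-suffices φ j) (almostSurely-suffices φ (suc j)))

almostSurely⇒negligible : ∀ {l σ} {P Q : ∀ {n} → Sample l σ n → Set} → AlmostSurely l σ P →
  (Q? : ∀ {n} → Decidable (Q {n})) → (∀ {n} {ω : Sample l σ n} → P ω → ¬ Q ω) →
  Negligible (λ n → count Q? (samples l σ n)) (λ n → length (samples l σ n))
almostSurely⇒negligible {l} {σ} asP Q? P⇒¬Q K with N , p ← asP K = N , small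
  where
  small : ∀ n → n ≥ N → K * count Q? (samples l σ n) ≤ length (samples l σ n)
  small n n≥N with bad , few , good ← p n n≥N =
    ≤-trans (*-monoʳ-≤ K (length-≤-by-inclusion (filter⁺ Q? (samples-! l σ n)) is-bad)) few
    where
    open DecMembership (_≟ω_ {l} {σ} {n}) using (_∈?_)
    is-bad : ∀ {ω} → ω ∈ filter Q? (samples l σ n) → ω ∈ bad
    is-bad {ω} ω∈ = decidable-stable (ω ∈? bad) λ ω∉ →
      P⇒¬Q (good ω ω∉) (proj₂ (∈-filter⁻ Q? {xs = samples l σ n} ω∈))

-- The zero-one law

module ZeroOne {l : ℕ} {σ : Vocabulary} (colour : Fin l) (σ≥2 : All (2 ≤_) σ)
  (allowed : ∀ {m} → Vec (Fin l) m → Bool)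
  (constant-forbidden : ∀ {m} → m ∈ σ → (cs : Vec (Fin l) m) → Constant cs → ¬ T (allowed cs))
  where

  open Admissible {l} {σ} allowed
  open Generic {l} {σ} allowed

  -- The given colour provides a sample of every size, so that all denominators are positive.
  sample : ∀ n → Sample l σ n
  sample n = Vec.replicate n colour , build λ _ _ → false

  -- Positive arities leave no tuples over the empty set, so all samples look the same from zero
  -- points. This makes the generic truth of a sentence a single question.
  pull-[] : (ω : Sample l σ n) → pull [] ω ≡ sample 0
  pull-[] ω = cong ([] ,_) (structure-ext λ R as → ⊥-elim (no-tuples (All.lookup σ≥2 R) as))
    where
    no-tuples : ∀ {m} → 2 ≤ m → ¬ Vec (Fin 0) m
    no-tuples _ (() ∷ _)

  0<samples : ∀ n → 0 < length (samples l σ n)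
  0<samples n = 0<length (∈-samples (sample n))

  -- If φ is not generically true, completeness confines its models to the exceptional samples; if
  -- it is, soundness does so for the models of its negation.
  zero-one : (φ : Sentence σ) {u : ℕ → ℚ} →
    (∀ n → u n ≡ ratio (count (λ ω → admit ω ⊨? φ) (samples l σ n)) (length (samples l σ n))) →
    (u ⟶ 0ℚ) ⊎ (u ⟶ 1ℚ)
  zero-one φ u≡ with genericTruth? φ (sample 0) []
  ... | no ¬generic = inj₁ (ratio⟶0 0<samples
    (almostSurely⇒negligible (almostSurely-suffices φ 0) (λ ω → admit ω ⊨? φ)
      λ {_} {ω} s h → ¬generic (subst (λ ω₀ → GenericTruth φ ω₀ []) (pull-[] ω)
        (completeness ω φ s [] (λ ()) [] h)))
    u≡)
  ... | yes generic = inj₂ (ratio⟶1 0<samples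
    (almostSurely⇒negligible (almostSurely-suffices φ 0) (λ ω → ¬? (admit ω ⊨? φ))
      λ {_} {ω} s ¬h → ¬h (soundness ω φ s [] (λ ()) []
        (subst (λ ω₀ → GenericTruth φ ω₀ []) (sym (pull-[] ω)) generic)))
    (λ n → count-+-count-¬ (λ ω → admit ω ⊨? φ) (samples l σ n)) u≡)

  module _
    (X : ∀ n → List (Structure (Coloured l σ) n)) (X! : ∀ n → Unique (X n))
    (expand-∈ : ∀ {n} (ω : Sample l σ n) → expand ω ∈ X n)
    (∈-expand : ∀ {n M} → M ∈ X n → ∃ λ ω → expand ω ≡ M)
    where

    δ-reduct : (φ : Sentence σ) (n : ℕ) →
      δ (X n) (λ M → reduct l M ∈ˢ? filter (_⊨? φ) (List.deduplicate _≟ˢ_ (map (reduct l) (X n))))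
        ≡ ratio (count (λ ω → admit ω ⊨? φ) (samples l σ n)) (length (samples l σ n))
    δ-reduct φ n = trans (δ-as-ratio Y?) (cong (λ a → ratio a (length (samples l σ n)))
      (count-cong (Y? ∘ expand) (λ ω → admit ω ⊨? φ)
        (λ {ω} ∈Y → subst (_⊨ φ [ [] ]) (reduct-expand ω) (proj₂ (∈-filter⁻ (_⊨? φ) {xs = reducts} ∈Y)))
        (λ {ω} h → ∈-filter⁺ (_⊨? φ) (∈-deduplicate⁺ _≟ˢ_ (∈-map⁺ (reduct l) (expand-∈ ω)))
          (subst (_⊨ φ [ [] ]) (sym (reduct-expand ω)) h))
        (samples l σ n)))
      where
      open Measure constant-forbidden (X n) (X! n) expand-∈ ∈-expand
      reducts = List.deduplicate _≟ˢ_ (map (reduct l) (X n))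
      Y? = λ M → reduct l M ∈ˢ? filter (_⊨? φ) reducts

    zero-one-law : (φ : Sentence σ) →
      let u = λ n → δ (X n) λ M →
            reduct l M ∈ˢ? filter (_⊨? φ) (List.deduplicate _≟ˢ_ (map (reduct l) (X n)))
      in (u ⟶ 0ℚ) ⊎ (u ⟶ 1ℚ)
    zero-one-law φ = zero-one φ (δ-reduct φ)

-- The two admissibility conditions

Colours : Structure (Coloured l σ) n → Vec (Fin l) n → Set
Colours {l} {σ} M c = ∀ a → HasColour l σ M a (lookup c a)

module _ {l : ℕ} {σ : Vocabulary} {n : ℕ} (M : Structure (Coloured l σ) n) (c : Vec (Fin l) n)
  (colours : Colours {l} {σ} M c) where

  colours⇒differentColours : (as : Vec (Fin n) m) (i j : Fin m) →
    lookup (Vec.map (lookup c) as) i ≢ lookup (Vec.map (lookup c) as) j →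
    DifferentColours l σ M (lookup as i) (lookup as j)
  colours⇒differentColours as i j differ = _ , _ , colours (lookup as i) , colours (lookup as j) ,
    λ eq → differ (trans (Vec.lookup-map i (lookup c) as) (trans eq (sym (Vec.lookup-map j (lookup c) as))))

  differentColours⇒≢ : OneColour l σ M → (as : Vec (Fin n) m) (i j : Fin m) →
    DifferentColours l σ M (lookup as i) (lookup as j) →
    lookup (Vec.map (lookup c) as) i ≢ lookup (Vec.map (lookup c) as) j
  differentColours⇒≢ one as i j (x , y , ix , jy , x≢y) eq = x≢y
    (trans (unique (lookup as i) x ix) (trans (sym (Vec.lookup-map i (lookup c) as))
      (trans eq (trans (Vec.lookup-map j (lookup c) as) (sym (unique (lookup as j) y jy))))))
    where
    unique : ∀ a x → HasColour l σ M a x → x ≡ lookup c a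
    unique a x h = trans (proj₂ (proj₂ (one a)) x h) (sym (proj₂ (proj₂ (one a)) _ (colours a)))

module Characterise {l : ℕ} {σ : Vocabulary} (allowed : ∀ {m} → Vec (Fin l) m → Bool) where

  open Admissible {l} {σ} allowed

  -- By `OneColour` there is just one such c. Quantifying over it states the condition without
  -- choosing how c is extracted from M.
  Admits : ∀ {n} → Structure (Coloured l σ) n → Set
  Admits {n} M = OneColour l σ M × (∀ c → Colours {l} {σ} M c →
    ∀ {m} (R : m ∈ σ) (as : Vec (Fin n) m) → Holds M (relSymbol l R) as → T (allowed (Vec.map (lookup c) as)))

  expand-colours : (ω : Sample l σ n) → Colours {l} {σ} (expand ω) (proj₁ ω)
  expand-colours ω a = subst T (sym (bit-expand-colour ω _ a)) (fromWitness refl)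

  expand-oneColour : (ω : Sample l σ n) → OneColour l σ (expand ω)
  expand-oneColour ω a = lookup (proj₁ ω) a , expand-colours ω a ,
    λ j h → sym (toWitness (subst T (bit-expand-colour ω j a) h))

  expand-allowed : (ω : Sample l σ n) (R : m ∈ σ) (as : Vec (Fin n) m) →
    Holds (expand ω) (relSymbol l R) as → T (allowed (Vec.map (lookup (proj₁ ω)) as))
  expand-allowed ω R as h = proj₂ (Equivalence.to T-∧ (subst T (bit-expand-rel ω R as) h))

  admits⇒expand : (M : Structure (Coloured l σ) n) → Admits M → ∃ λ ω → expand ω ≡ M
  admits⇒expand M (one , ok) = ω , coloured-ext
    (λ i a → trans (bit-expand-colour ω i a) (T-ext
      (λ t → subst (HasColour l σ M a) (toWitness t) (colours a))
      (λ h → fromWitness (trans (Vec.lookup∘tabulate _ a) (sym (proj₂ (proj₂ (one a)) i h))))))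
    λ R as → trans (bit-expand-rel ω R as)
      (trans (cong (_∧ _) (bit-reduct l M R as)) (T-ext
        (λ t → proj₁ (Equivalence.to T-∧ t))
        (λ h → Equivalence.from T-∧ (h , ok (proj₁ ω) colours R as h))))
    where
    -- No tuple in the reduct of M is forbidden, so the reduct itself serves as the relations:
    -- deletion leaves it unchanged.
    ω : Sample l σ _
    ω = Vec.tabulate (proj₁ ∘ one) , reduct l M
    colours : Colours {l} {σ} M (proj₁ ω)
    colours a = subst (HasColour l σ M a) (sym (Vec.lookup∘tabulate _ a)) (proj₁ (proj₂ (one a)))

module _ {l : ℕ} where

  someDifferent? : (cs : Vec (Fin l) m) → Dec (∃ λ i → ∃ λ j → lookup cs i ≢ lookup cs j)
  someDifferent? cs = Fin.any? λ i → Fin.any? λ j → ¬? (lookup cs i Fin.≟ lookup cs j)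

  allDifferent? : (cs : Vec (Fin l) m) → Dec (∀ i j → i ≢ j → lookup cs i ≢ lookup cs j)
  allDifferent? cs = Fin.all? λ i → Fin.all? λ j → ¬? (i Fin.≟ j) →-dec ¬? (lookup cs i Fin.≟ lookup cs j)

-- The law for each of the two classes

zero-one-𝐊 : ∀ {l} → Fin l → ∀ {σ} → All (2 ≤_) σ → (φ : Sentence σ) →
  (δᶜ⟨ φ ⟩ l ⟶ 0ℚ) ⊎ (δᶜ⟨ φ ⟩ l ⟶ 1ℚ)
zero-one-𝐊 {l} colour {σ} σ≥2 = zero-one-law (𝐊 l σ)
  (λ n → filter⁺ (isK? l σ) (structures-! (Coloured l σ) n)) expand-∈ ∈-expand
  where
  allowed : ∀ {m} → Vec (Fin l) m → Bool
  allowed cs = ⌊ someDifferent? cs ⌋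

  constant-forbidden : ∀ {m} → m ∈ σ → (cs : Vec (Fin l) m) → Constant cs → ¬ T (allowed cs)
  constant-forbidden _ cs const t with i , j , differ ← toWitness t = differ (const i j)

  open Admissible {l} {σ} allowed
  open Characterise {l} {σ} allowed
  open ZeroOne {l} {σ} colour σ≥2 allowed constant-forbidden

  expand-∈ : (ω : Sample l σ n) → expand ω ∈ 𝐊 l σ n
  expand-∈ ω = ∈-filter⁺ (isK? l σ) (∈-structures (expand ω)) (expand-oneColour ω , λ R as h →
    let i , j , differ = toWitness (expand-allowed ω R as h) in
    i , j , colours⇒differentColours (expand ω) (proj₁ ω) (expand-colours ω) as i j differ)

  ∈-expand : ∀ {n M} → M ∈ 𝐊 l σ n → ∃ λ ω → expand ω ≡ M
  ∈-expand {n} {M} M∈ with one , some ← proj₂ (∈-filter⁻ (isK? l σ) {xs = structures (Coloured l σ) n} M∈) =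
    admits⇒expand M (one , λ c colours R as h →
      let i , j , differ = some R as h in
      fromWitness (i , j , differentColours⇒≢ M c colours one as i j differ))

zero-one-𝐒𝐊 : ∀ {l} → Fin l → ∀ {σ} → All (2 ≤_) σ → (φ : Sentence σ) →
  (δˢ⟨ φ ⟩ l ⟶ 0ℚ) ⊎ (δˢ⟨ φ ⟩ l ⟶ 1ℚ)
zero-one-𝐒𝐊 {l} colour {σ} σ≥2 = zero-one-law (𝐒𝐊 l σ)
  (λ n → filter⁺ (isSK? l σ) (structures-! (Coloured l σ) n)) expand-∈ ∈-expand
  where
  allowed : ∀ {m} → Vec (Fin l) m → Bool
  allowed cs = ⌊ allDifferent? cs ⌋

  constant-forbidden : ∀ {m} → m ∈ σ → (cs : Vec (Fin l) m) → Constant cs → ¬ T (allowed cs)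
  constant-forbidden R cs const t with All.lookup σ≥2 R
  -- Arity at least 2 supplies two different positions, to which a constant tuple gives the same
  -- colour.
  ... | s≤s (s≤s _) = toWitness t zero (suc zero) (λ ()) (const zero (suc zero))

  open Admissible {l} {σ} allowed
  open Characterise {l} {σ} allowed
  open ZeroOne {l} {σ} colour σ≥2 allowed constant-forbidden

  expand-∈ : (ω : Sample l σ n) → expand ω ∈ 𝐒𝐊 l σ n
  expand-∈ ω = ∈-filter⁺ (isSK? l σ) (∈-structures (expand ω)) (expand-oneColour ω , λ R as h i j i≢j →
    colours⇒differentColours (expand ω) (proj₁ ω) (expand-colours ω) as i j
      (toWitness (expand-allowed ω R as h) i j i≢j))

  ∈-expand : ∀ {n M} → M ∈ 𝐒𝐊 l σ n → ∃ λ ω → expand ω ≡ M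
  ∈-expand {n} {M} M∈ with one , all ← proj₂ (∈-filter⁻ (isSK? l σ) {xs = structures (Coloured l σ) n} M∈) =
    admits⇒expand M (one , λ c colours R as h → fromWitness λ i j i≢j →
      differentColours⇒≢ M c colours one as i j (all R as h i j i≢j))

theorem9p1 : (l : ℕ) → 2 ≤ l →
    (σ : Vocabulary) → σ ≢ [] → All (2 ≤_) σ →
    (φ : Sentence σ) →
    (((λ n → δᶜ⟨ φ ⟩ l n) ⟶ 0ℚ) ⊎ ((λ n → δᶜ⟨ φ ⟩ l n) ⟶ 1ℚ)) ×
    (All (_≤ l) σ →
    ((λ n → δˢ⟨ φ ⟩ l n) ⟶ 0ℚ) ⊎ ((λ n → δˢ⟨ φ ⟩ l n) ⟶ 1ℚ))
theorem9p1 (suc l) _ σ _ σ≥2 φ = zero-one-𝐊 zero σ≥2 φ , λ _ → zero-one-𝐒𝐊 zero σ≥2 φ
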